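{- Let $S:\mathcal{T}\to\mathcal{T}$ be the antipode of the Hopf algebra $\mathcal{T}$. For every $n\ge1$ and every $\pi\in NC(n)\setminus\{1_n\}$ one has $$ S(X_\pi)=\sum_{c\in\mathcal{EC}(\pi,1_n)}(-1)^{|\mathrm{Blocks}^+(c)|}\,M_c, $$ where $\mathcal{EC}(\pi,1_n)$ is the set of efficient chains from $\pi$ to $1_n$ in $NC(n)$.
   Context: $NC(n)$ is the set of non-crossing partitions of $\{1,\ldots,n\}$, ordered by reverse refinement ($\pi\le\sigma$ iff every block of $\sigma$ is a union of blocks of $\pi$); $\pi<\sigma$ means $\pi\le\sigma$ and $\pi\ne\sigma$; $1_n\in NC(n)$ is the partition with one block. For $\pi \in NC(n)$ and a non-empty $W = \{p_1 < \cdots < p_m\} \subseteq \{1,\ldots,n\}$, $\pi_W \in NC(m)$ is the partition for which $i,j$ are in the same block of $\pi_W$ iff $p_i,p_j$ are in the same block of $\pi$. $\mathcal{T}=\mathbb{C}\bigl[X_\pi\mid\pi\in\sqcup_{n=1}^\infty(NC(n)\setminus\{1_n\})\bigr]$ is the commutative polynomial algebra, with the convention $X_{1_n}:=1_{\mathcal{T}}$. It is a Hopf algebra with comultiplication the unital algebra homomorphism determined by $\Delta(X_\pi)=\sum_{\sigma\in NC(n),\ \sigma\ge\pi}\bigl(\prod_{W\in\sigma}X_{\pi_W}\bigr)\otimes X_\sigma$, and with counit the unital algebra homomorphism determined by $\epsilon(X_\pi)=0$ for $\pi\in\sqcup_n(NC(n)\setminus\{1_n\})$. The antipode $S$ is the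 inverse of the identity map under convolution of linear maps $\mathcal{T}\to\mathcal{T}$, $F'*F''=m\circ(F'\otimes F'')\circ\Delta$ with $m$ the multiplication map, the unit for this convolution being $P\mapsto\epsilon(P)1_{\mathcal{T}}$. For $\pi\le\sigma$ in $NC(n)$, $M_{\pi,\sigma}:=\prod_{W\in\sigma}X_{\pi_W}\in\mathcal{T}$. For $\pi<\sigma$ in $NC(n)$, a chain from $\pi$ to $\sigma$ is a tuple $c=(\pi_0,\pi_1,\ldots,\pi_k)$ in $NC(n)$ with $\pi=\pi_0<\pi_1<\cdots<\pi_k=\sigma$; put $M_c:=M_{\pi_0,\pi_1}M_{\pi_1,\pi_2}\cdots M_{\pi_{k-1},\pi_k}$. $\mathrm{Blocks}(c)$ is the set of subsets $V\subseteq\{1,\ldots,n\}$ such that $V$ is a block of $\pi_j$ for some $0\le j\le k$, and $\mathrm{Blocks}^+(c)$ is the set of those $V\in\mathrm{Blocks}(c)$ which are not blocks of $\pi_0$. The chain $c$ is efficient if for every $V\in\mathrm{Blocks}^+(c)$ there exists a unique $j\in\{1,\ldots,k\}$ such that $V$ is a block of $\pi_j$. $\mathcal{EC}(\pi,\sigma)$ is the set of all efficient chains from $\pi$ to $\sigma$. -}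

module Defs where

open import Algebra.Bundles using (CommutativeMonoid; CommutativeRing; RawRing)
import Algebra.Properties.CommutativeSemigroup as CommutativeSemigroupProperties
import Algebra.Properties.Ring as RingProperties
import Algebra.Definitions.RawSemiring as RawSemiringDefs
open import Algebra.Module.Bundles using (Module)
open import Algebra.Module.Morphism.Structures using (module ModuleMorphisms)
open import Algebra.Module.Structures.Biased using (module IsModuleFromLeft)
import Algebra.Morphism.Construct.Identity as RingIdentity
open import Algebra.Morphism.Structures using (module RingMorphisms)
import Data.Bool.Properties as Bool
open import Data.Empty using (⊥-elim)
open import Data.Fin.Base as Fin using (Fin; zero; suc)
import Data.Fin.Properties as Fin
open import Data.Fin.Subset as Subset using (Subset; inside; outside; ⋃; ∣_∣)
  renaming (_∈_ to _∈ₛ_; _⊆_ to _⊆ₛ_)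
import Data.Fin.Subset.Properties as Subset
open import Data.List.Base as List
  using (List; []; _∷_; map; filter; foldr; length; cartesianProductWith; mapMaybe; allFin; last)
open import Data.List.Membership.Propositional using (_∈_)
open import Data.List.Membership.Propositional.Properties
  using (∈-map⁺; ∈-map⁻; ∈-filter⁺; ∈-filter⁻; ∈-allFin; ∈-lookup; ∈-cartesianProductWith⁺)
open import Data.List.NonEmpty.Base as List⁺ using (List⁺; _∷_; toList)
open import Data.List.Relation.Unary.All as All using (All; []; _∷_)
import Data.List.Relation.Unary.All.Properties as All
open import Data.List.Relation.Unary.AllPairs as AllPairs using (AllPairs; []; _∷_)
open import Data.List.Relation.Unary.Any as Any using (Any; here; there)
import Data.List.Relation.Unary.Any.Properties as Any
open import Data.List.Relation.Unary.Linked as Linked using (Linked)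
open import Data.List.Relation.Unary.Linked.Properties using (Linked⇒AllPairs)
open import Data.List.Relation.Unary.Unique.Propositional using (Unique)
import Data.List.Relation.Unary.Unique.Propositional.Properties as Unique
open import Data.Maybe.Base using (Maybe; just; nothing)
import Data.Maybe.Properties as Maybe
open import Data.Nat.Base as ℕ using (ℕ; zero; suc)
import Data.Nat.Properties as ℕ
open import Data.Product using (_×_; _,_; proj₁; proj₂; ∃; ∃!)
open import Data.Sum.Base using (inj₁; inj₂)
open import Data.Vec.Base as Vec using (Vec; []; _∷_; lookup; tabulate; replicate)
import Data.Vec.Properties as Vec
import Data.Vec.Relation.Binary.Equality.Propositional as VecEq
open import Function.Base using (_∘_; id)
open import Function.Bundles using (_⇔_; mk⇔)
open import Level using (Level; _⊔_)
open import Relation.Binary.Definitions using (DecidableEquality)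
open import Relation.Binary.PropositionalEquality as ≡ using (_≡_; _≢_; refl)
open import Relation.Binary.Structures using (IsEquivalence)
open import Relation.Nullary using (¬_; Dec; yes; no; contradiction)
open import Relation.Nullary.Decidable using (map′; recompute; _×-dec_; _→-dec_; ¬?)

private
  variable
    a : Level
    A : Set a
    m n : ℕ

------------------------------------------------------------------------
-- Finite enumerations

allVecs : List A → ∀ n → List (Vec A n)
allVecs xs zero    = [] ∷ []
allVecs xs (suc n) = cartesianProductWith _∷_ xs (allVecs xs n)

∈-allVecs : ∀ {xs : List A} → (∀ x → x ∈ xs) → (v : Vec A n) → v ∈ allVecs xs n
∈-allVecs all []      = here refl
∈-allVecs all (x ∷ v) = ∈-cartesianProductWith⁺ _∷_ (all x) (∈-allVecs all v)

allVecs-unique : ∀ {xs : List A} → Unique xs → ∀ n → Unique (allVecs xs n)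
allVecs-unique xs! zero    = [] ∷ []
allVecs-unique xs! (suc n) =
  Unique.cartesianProductWith⁺ _∷_ Vec.∷-injective xs! (allVecs-unique xs! n)

allSubsets : ∀ n → List (Subset n)
allSubsets = allVecs (outside ∷ inside ∷ [])

∈-allSubsets : (V : Subset n) → V ∈ allSubsets n
∈-allSubsets = ∈-allVecs λ where
  outside → here refl
  inside  → there (here refl)

allSubsets-unique : ∀ n → Unique (allSubsets n)
allSubsets-unique = allVecs-unique (((λ ()) ∷ []) ∷ [] ∷ [])

-- All lists of length at most k with entries in xs.
listsUpTo : List A → ℕ → List (List A)
listsUpTo xs zero    = [] ∷ []
listsUpTo xs (suc k) = [] ∷ cartesianProductWith _∷_ xs (listsUpTo xs k)

∈-listsUpTo : ∀ {xs : List A} → (∀ x → x ∈ xs) →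
              ∀ {k} ys → length ys ℕ.≤ k → ys ∈ listsUpTo xs k
∈-listsUpTo all {zero}  []       _           = here refl
∈-listsUpTo all {suc k} []       _           = here refl
∈-listsUpTo all {suc k} (y ∷ ys) (ℕ.s≤s len) =
  there (∈-cartesianProductWith⁺ _∷_ (all y) (∈-listsUpTo all ys len))

private
  ∷-inj : ∀ {x y : A} {xs ys : List A} → List._∷_ x xs ≡ y ∷ ys → x ≡ y × xs ≡ ys
  ∷-inj refl = refl , refl

  ∷⁺-inj : ∀ {x y : A} {xs ys : List A} → List⁺._∷_ x xs ≡ y ∷ ys → x ≡ y × xs ≡ ys
  ∷⁺-inj refl = refl , refl

  []∉ : ∀ (xs : List A) yss → All ([] ≢_) (cartesianProductWith List._∷_ xs yss)
  []∉ []       yss = []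
  []∉ (x ∷ xs) yss =
    All.++⁺ (All.map⁺ (All.universal (λ _ ()) yss)) ([]∉ xs yss)

listsUpTo-unique : ∀ {xs : List A} → Unique xs → ∀ k → Unique (listsUpTo xs k)
listsUpTo-unique xs! zero    = [] ∷ []
listsUpTo-unique {xs = xs} xs! (suc k) =
  []∉ xs (listsUpTo xs k) ∷
  Unique.cartesianProductWith⁺ _∷_ ∷-inj xs! (listsUpTo-unique xs! k)

private
  unique-lookup : ∀ {xs : List A} → Unique xs → ∀ {i j} → i Fin.< j →
                  List.lookup xs i ≢ List.lookup xs j
  unique-lookup (x∉ ∷ _) {zero}  {suc j} _           eq = All.lookup x∉ (∈-lookup j) eq
  unique-lookup (_ ∷ u)  {suc i} {suc j} (ℕ.s≤s i<j) eq = unique-lookup u i<j eq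

unique-length : ∀ {xs ys : List A} → Unique xs → (∀ x → x ∈ ys) → length xs ℕ.≤ length ys
unique-length {xs = xs} {ys} xs! all with length xs ℕ.≤? length ys
... | yes p = p
... | no ¬p with Fin.pigeonhole (ℕ.≰⇒> ¬p) (λ i → Any.index (all (List.lookup xs i)))
...   | i , j , i<j , eq = contradiction
          (≡.trans (Any.lookup-index (all (List.lookup xs i)))
            (≡.trans (≡.cong (List.lookup ys) eq)
              (≡.sym (Any.lookup-index (all (List.lookup xs j))))))
          (unique-lookup xs! i<j)

------------------------------------------------------------------------
-- Non-crossing partitions

-- A partition of Fin n is given by the vector B whose i-th entry is the
-- block containing i; i ∼ j says that i and j lie in the same block.
module _ (B : Vec (Subset n) n) where

  private
    _∼_ : Fin n → Fin n → Set
    i ∼ j = j ∈ₛ lookup B i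

    _∼?_ : ∀ i j → Dec (i ∼ j)
    i ∼? j = j Subset.∈? lookup B i

  record IsNonCrossingPartition : Set where
    field
      isEquivalence : IsEquivalence _∼_
      noncrossing   : ∀ {i j k l} → i Fin.< j → j Fin.< k → k Fin.< l →
                      i ∼ k → j ∼ l → i ∼ j

  isNonCrossingPartition? : Dec IsNonCrossingPartition
  isNonCrossingPartition? = map′
    (λ (r , s , t , nc) → record
      { isEquivalence = record
          { refl = λ {i} → r i ; sym = λ {i} {j} → s i j ; trans = λ {i} {j} {k} → t i j k }
      ; noncrossing = λ {i} {j} {k} {l} → nc i j k l })
    (λ p → let open IsNonCrossingPartition p
               module E = IsEquivalence isEquivalence in
      (λ _ → E.refl) , (λ _ _ → E.sym) , (λ _ _ _ → E.trans) , (λ _ _ _ _ → noncrossing))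
    (Fin.all? (λ i → i ∼? i)
      ×-dec Fin.all? (λ i → Fin.all? λ j → (i ∼? j) →-dec (j ∼? i))
      ×-dec Fin.all? (λ i → Fin.all? λ j → Fin.all? λ k →
              (i ∼? j) →-dec ((j ∼? k) →-dec (i ∼? k)))
      ×-dec Fin.all? (λ i → Fin.all? λ j → Fin.all? λ k → Fin.all? λ l →
              (i Fin.<? j) →-dec ((j Fin.<? k) →-dec ((k Fin.<? l) →-dec
              ((i ∼? k) →-dec ((j ∼? l) →-dec (i ∼? j)))))))

-- The proof field is irrelevant, so two partitions with the same blocks
-- are propositionally equal.
record NC (n : ℕ) : Set where
  constructor mkNC
  field
    classes : Vec (Subset n) n
    .isNC   : IsNonCrossingPartition classes

  class : Fin n → Subset n
  class = lookup classes

  _∼_ : Fin n → Fin n → Set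
  i ∼ j = j ∈ₛ class i

open NC public using (classes; class)

module NCProperties (π : NC n) where
  isNonCrossingPartition : IsNonCrossingPartition (classes π)
  isNonCrossingPartition = let mkNC B p = π in recompute (isNonCrossingPartition? B) p

  open IsNonCrossingPartition isNonCrossingPartition public
  open IsEquivalence isEquivalence public
    renaming (refl to ∼-refl; sym to ∼-sym; trans to ∼-trans) using ()

NC-≡ : ∀ {π σ : NC n} → classes π ≡ classes σ → π ≡ σ
NC-≡ {π = mkNC _ _} {mkNC _ _} refl = refl

_≟_ : DecidableEquality (NC n)
π ≟ σ = map′ NC-≡ (≡.cong classes) (Vec.≡-dec (Vec.≡-dec Bool._≟_) (classes π) (classes σ))

_≟ₛ_ : DecidableEquality (Subset n)
_≟ₛ_ = Vec.≡-dec Bool._≟_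

toNC : Vec (Subset n) n → Maybe (NC n)
toNC B with isNonCrossingPartition? B
... | yes p = just (mkNC B p)
... | no _  = nothing

allNC : ∀ n → List (NC n)
allNC n = mapMaybe toNC (allVecs (allSubsets n) n)

private
  ∈-mapMaybe-toNC : (π : NC n) → ∀ {Bs} → classes π ∈ Bs → π ∈ mapMaybe toNC Bs
  ∈-mapMaybe-toNC π {B ∷ Bs} B∈ with isNonCrossingPartition? B | B∈
  ... | yes p | here eq  = here (NC-≡ eq)
  ... | yes p | there q  = there (∈-mapMaybe-toNC π q)
  ... | no ¬p | here refl = contradiction (NCProperties.isNonCrossingPartition π) ¬p
  ... | no ¬p | there q  = ∈-mapMaybe-toNC π q

  ∉-mapMaybe-toNC : ∀ {B : Vec (Subset n) n} .{p} {Bs} → All (B ≢_) Bs →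
                    All (mkNC B p ≢_) (mapMaybe toNC Bs)
  ∉-mapMaybe-toNC {Bs = []}      []       = []
  ∉-mapMaybe-toNC {Bs = B′ ∷ Bs} (B≢ ∷ h) with isNonCrossingPartition? B′
  ... | yes _ = (B≢ ∘ ≡.cong classes) ∷ ∉-mapMaybe-toNC h
  ... | no _  = ∉-mapMaybe-toNC h

  mapMaybe-toNC-unique : {Bs : List (Vec (Subset n) n)} → Unique Bs → Unique (mapMaybe toNC Bs)
  mapMaybe-toNC-unique {Bs = []}     []       = []
  mapMaybe-toNC-unique {Bs = B ∷ Bs} (B∉ ∷ u) with isNonCrossingPartition? B
  ... | yes _ = ∉-mapMaybe-toNC B∉ ∷ mapMaybe-toNC-unique u
  ... | no _  = mapMaybe-toNC-unique u

∈-allNC : (π : NC n) → π ∈ allNC n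
∈-allNC π = ∈-mapMaybe-toNC π (∈-allVecs ∈-allSubsets (classes π))

allNC-unique : ∀ n → Unique (allNC n)
allNC-unique n = mapMaybe-toNC-unique (allVecs-unique (allSubsets-unique n) n)

-- For n = 0 this is the only element of NC 0.
𝟙 : ∀ n → NC n
𝟙 n = mkNC (replicate n Subset.⊤) record
  { isEquivalence = record { refl = related ; sym = λ _ → related ; trans = λ _ _ → related }
  ; noncrossing   = λ _ _ _ _ _ → related
  }
  where
  related : ∀ {i j} → j ∈ₛ lookup (replicate n Subset.⊤) i
  related {i} = ≡.subst (_ ∈ₛ_) (≡.sym (Vec.lookup-replicate i Subset.⊤)) Subset.∈⊤

------------------------------------------------------------------------
-- Blocks and reverse refinement

IsBlock : NC n → Subset n → Set
IsBlock π V = ∃ λ i → V ≡ class π i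

isBlock? : (π : NC n) (V : Subset n) → Dec (IsBlock π V)
isBlock? π V = Fin.any? (λ i → V ≟ₛ class π i)

blocks : NC n → List (Subset n)
blocks {n} π = filter (isBlock? π) (allSubsets n)

infix 4 _≤_ _<_

_≤_ : NC n → NC n → Set
π ≤ σ = ∀ V → IsBlock σ V → ∃ λ Bs → All (IsBlock π) Bs × V ≡ ⋃ Bs

_<_ : NC n → NC n → Set
π < σ = π ≤ σ × π ≢ σ

private
  ∈-⋃⁺ : ∀ {x : Fin n} {B Bs} → x ∈ₛ B → B ∈ Bs → x ∈ₛ ⋃ Bs
  ∈-⋃⁺ x∈B (here refl) = Subset.x∈p∪q⁺ (inj₁ x∈B)
  ∈-⋃⁺ x∈B (there B∈)  = Subset.x∈p∪q⁺ (inj₂ (∈-⋃⁺ x∈B B∈))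

  ∈-⋃⁻ : ∀ {x : Fin n} Bs → x ∈ₛ ⋃ Bs → ∃ λ B → x ∈ₛ B × B ∈ Bs
  ∈-⋃⁻ []       x∈ = ⊥-elim (Subset.∉⊥ x∈)
  ∈-⋃⁻ (B ∷ Bs) x∈ with Subset.x∈p∪q⁻ B (⋃ Bs) x∈
  ... | inj₁ x∈B = B , x∈B , here refl
  ... | inj₂ x∈⋃ = let B′ , x∈B′ , B′∈ = ∈-⋃⁻ Bs x∈⋃ in B′ , x∈B′ , there B′∈

≤⇒∼ : (π σ : NC n) → π ≤ σ → ∀ i j → NC._∼_ π i j → NC._∼_ σ i j
≤⇒∼ π σ π≤σ i j i∼j with π≤σ (class σ i) (i , refl)
... | Bs , allBs , eq with ∈-⋃⁻ Bs (≡.subst (i ∈ₛ_) eq (NCProperties.∼-refl σ))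
...   | B , i∈B , B∈ with All.lookup allBs B∈
...     | k , refl = ≡.subst (j ∈ₛ_) (≡.sym eq) (∈-⋃⁺ (NCProperties.∼-trans π i∈B i∼j) B∈)

∼⇒≤ : (π σ : NC n) → (∀ i j → NC._∼_ π i j → NC._∼_ σ i j) → π ≤ σ
∼⇒≤ {n} π σ π⊆σ _ (i , refl) = Bs , All.map⁺ (All.universal (λ k → k , refl) ks) ,
                               Subset.⊆-antisym to from
  where
  ks = filter (Subset._∈? class σ i) (allFin n)
  Bs = map (class π) ks

  to : class σ i ⊆ₛ ⋃ Bs
  to {x} x∈ = ∈-⋃⁺ (NCProperties.∼-refl π)
                (∈-map⁺ (class π) (∈-filter⁺ (Subset._∈? class σ i) (∈-allFin x) x∈))

  from : ⋃ Bs ⊆ₛ class σ i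
  from {x} x∈ with ∈-⋃⁻ Bs x∈
  ... | B , x∈B , B∈ with ∈-map⁻ (class π) B∈
  ...   | k , k∈ , refl = NCProperties.∼-trans σ
                            (proj₂ (∈-filter⁻ (Subset._∈? class σ i) {xs = allFin n} k∈)) (π⊆σ k x x∈B)

_≤?_ : (π σ : NC n) → Dec (π ≤ σ)
π ≤? σ = map′ (∼⇒≤ π σ) (≤⇒∼ π σ)
  (Fin.all? λ i → Fin.all? λ j → (j Subset.∈? class π i) →-dec (j Subset.∈? class σ i))

_<?_ : (π σ : NC n) → Dec (π < σ)
π <? σ = (π ≤? σ) ×-dec ¬? (π ≟ σ)

≤-trans : {π ρ σ : NC n} → π ≤ ρ → ρ ≤ σ → π ≤ σ
≤-trans {π = π} {ρ} {σ} p q = ∼⇒≤ π σ λ i j → ≤⇒∼ ρ σ q i j ∘ ≤⇒∼ π ρ p i j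

≤-antisym : {π σ : NC n} → π ≤ σ → σ ≤ π → π ≡ σ
≤-antisym {π = π} {σ} p q = NC-≡ (≡.trans (≡.sym (Vec.tabulate∘lookup (classes π)))
  (≡.trans (Vec.tabulate-cong λ i → Subset.⊆-antisym (≤⇒∼ π σ p i _) (≤⇒∼ σ π q i _))
           (Vec.tabulate∘lookup (classes σ))))

<-trans : {π ρ σ : NC n} → π < ρ → ρ < σ → π < σ
<-trans {π = π} {ρ} {σ} (p , π≢ρ) (q , _) =
  ≤-trans {π = π} {ρ} {σ} p q , λ { refl → π≢ρ (≤-antisym p q) }

------------------------------------------------------------------------
-- Restriction

-- The increasing enumeration p₁ < ⋯ < pₘ of a subset.
element : (W : Subset n) → Fin ∣ W ∣ → Fin n
element (inside  ∷ W) zero    = zero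
element (inside  ∷ W) (suc i) = suc (element W i)
element (outside ∷ W) i       = suc (element W i)

element-mono : (W : Subset n) → ∀ {i j} → i Fin.< j → element W i Fin.< element W j
element-mono (inside  ∷ W) {zero}  {suc j} _           = ℕ.s≤s ℕ.z≤n
element-mono (inside  ∷ W) {suc i} {suc j} (ℕ.s≤s i<j) = ℕ.s≤s (element-mono W i<j)
element-mono (outside ∷ W) i<j                         = ℕ.s≤s (element-mono W i<j)

module Restriction (π : NC n) (W : Subset n) where
  private
    p = element W
    module π = NCProperties π

  restrictedClasses : Vec (Subset ∣ W ∣) ∣ W ∣
  restrictedClasses = tabulate λ i → tabulate λ j → lookup (class π (p i)) (p j)

  private
    entry : ∀ i j → lookup (lookup restrictedClasses i) j ≡ lookup (class π (p i)) (p j)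
    entry i j = ≡.trans
      (≡.cong (λ V → lookup V j) (Vec.lookup∘tabulate _ i))
      (Vec.lookup∘tabulate _ j)

    to : ∀ {i j} → j ∈ₛ lookup restrictedClasses i → p j ∈ₛ class π (p i)
    to {i} {j} j∈ = Vec.lookup⇒[]= _ _ (≡.trans (≡.sym (entry i j)) (Vec.[]=⇒lookup j∈))

    from : ∀ {i j} → p j ∈ₛ class π (p i) → j ∈ₛ lookup restrictedClasses i
    from {i} {j} j∈ = Vec.lookup⇒[]= _ _ (≡.trans (entry i j) (Vec.[]=⇒lookup j∈))

  restrict : NC ∣ W ∣
  restrict = mkNC restrictedClasses record
    { isEquivalence = record
        { refl  = from π.∼-refl
        ; sym   = from ∘ π.∼-sym ∘ to
        ; trans = λ q r → from (π.∼-trans (to q) (to r))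
        }
    ; noncrossing = λ i<j j<k k<l i∼k j∼l → from
        (π.noncrossing (element-mono W i<j) (element-mono W j<k) (element-mono W k<l)
          (to i∼k) (to j∼l))
    }

  restrict-∼ : ∀ i j → NC._∼_ restrict i j ⇔ NC._∼_ π (p i) (p j)
  restrict-∼ i j = mk⇔ to from

open Restriction public using (restrict; restrict-∼)

------------------------------------------------------------------------
-- Efficient chains

-- A tuple (π₀, …, πₖ) is the non-empty list with head π₀ and tail
-- π₁, …, πₖ. For π < σ the end conditions force k ≥ 1.
Tuple : ℕ → Set
Tuple n = List⁺ (NC n)

record IsChain (π σ : NC n) (c : Tuple n) : Set where
  constructor mkChain
  field
    starts    : List⁺.head c ≡ π
    ends      : last (toList c) ≡ just σ
    ascending : Linked _<_ (toList c)

InBlocks : Tuple n → Subset n → Set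
InBlocks c V = Any (λ ρ → IsBlock ρ V) (toList c)

InBlocks⁺ : Tuple n → Subset n → Set
InBlocks⁺ c V = InBlocks c V × ¬ IsBlock (List⁺.head c) V

inBlocks⁺? : (c : Tuple n) (V : Subset n) → Dec (InBlocks⁺ c V)
inBlocks⁺? c V = Any.any? (λ ρ → isBlock? ρ V) (toList c) ×-dec ¬? (isBlock? (List⁺.head c) V)

Blocks⁺ : Tuple n → List (Subset n)
Blocks⁺ {n} c = filter (inBlocks⁺? c) (allSubsets n)

Efficient : Tuple n → Set
Efficient {n} c = ∀ (V : Subset n) → InBlocks⁺ c V →
  ∃! _≡_ λ (j : Fin (length (List⁺.tail c))) → IsBlock (List.lookup (List⁺.tail c) j) V

efficient? : (c : Tuple n) → Dec (Efficient c)
efficient? {n} c = map′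
  (λ h V → All.lookup h (∈-allSubsets V))
  (λ h → All.universal h (allSubsets n))
  (All.all? (λ V → inBlocks⁺? c V →-dec
    map′ (λ (j , b , u) → j , b , λ {i} → u i)
         (λ (j , b , u) → j , b , λ i → u {i})
         (Fin.any? λ j → isBlock? (List.lookup (List⁺.tail c) j) V
            ×-dec Fin.all? λ i → isBlock? (List.lookup (List⁺.tail c) i) V →-dec (j Fin.≟ i)))
    (allSubsets n))

isChain? : (π σ : NC n) (c : Tuple n) → Dec (IsChain π σ c)
isChain? π σ c = map′
  (λ (s , e , a) → mkChain s e a)
  (λ (mkChain s e a) → s , e , a)
  ((List⁺.head c ≟ π) ×-dec Maybe.≡-dec _≟_ (last (toList c)) (just σ)
    ×-dec Linked.linked? _<?_ (toList c))

IsEfficientChain : (π σ : NC n) → Tuple n → Set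
IsEfficientChain π σ c = IsChain π σ c × Efficient c

isEfficientChain? : (π σ : NC n) (c : Tuple n) → Dec (IsEfficientChain π σ c)
isEfficientChain? π σ c = isChain? π σ c ×-dec efficient? c

-- The length bound loses nothing: the entries of a chain are distinct.
EC : (π σ : NC n) → List (Tuple n)
EC {n} π σ = filter (isEfficientChain? π σ)
  (cartesianProductWith _∷_ (allNC n) (listsUpTo (allNC n) (length (allNC n))))

∈-EC : ∀ {π σ : NC n} {c} → c ∈ EC π σ ⇔ IsEfficientChain π σ c
∈-EC {n} {π} {σ} {c} = mk⇔
  (proj₂ ∘ ∈-filter⁻ (isEfficientChain? π σ) {xs = tuples})
  (λ e → ∈-filter⁺ (isEfficientChain? π σ) (enumerated c (IsChain.ascending (proj₁ e))) e)
  where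
  tuples = cartesianProductWith List⁺._∷_ (allNC n) (listsUpTo (allNC n) (length (allNC n)))

  enumerated : ∀ c → Linked _<_ (toList c) → c ∈ tuples
  enumerated (ρ ∷ ρs) asc = ∈-cartesianProductWith⁺ _∷_ (∈-allNC ρ)
    (∈-listsUpTo ∈-allNC ρs
      (unique-length (AllPairs.map proj₂ (Linked⇒AllPairs (λ {π} {ρ} {σ} → <-trans {π = π} {ρ} {σ}) (Linked.tail asc))) ∈-allNC))

EC-unique : (π σ : NC n) → Unique (EC π σ)
EC-unique {n} π σ = Unique.filter⁺ (isEfficientChain? π σ)
  (Unique.cartesianProductWith⁺ _∷_ ∷⁺-inj (allNC-unique n)
    (listsUpTo-unique (allNC-unique n) (length (allNC n))))

------------------------------------------------------------------------
-- Polynomial algebras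

module Polynomials {c ℓ} (K : CommutativeRing c ℓ) (I : Set) where

  private
    module K = CommutativeRing K

  infixl 6 _⊕_
  infixl 7 _⊛_
  infix  4 _≈ₚ_

  -- K[X_i | i ∈ I] as the free commutative K-algebra on I: terms modulo
  -- the congruence generated by the axioms.  Negation is multiplication
  -- by the constant -1.
  data Polynomial : Set c where
    con : K.Carrier → Polynomial
    var : I → Polynomial
    _⊕_ : Polynomial → Polynomial → Polynomial
    _⊛_ : Polynomial → Polynomial → Polynomial

  data _≈ₚ_ : Polynomial → Polynomial → Set (c ⊔ ℓ) where
    ≈-refl  : ∀ {p} → p ≈ₚ p
    ≈-sym   : ∀ {p q} → p ≈ₚ q → q ≈ₚ p
    ≈-trans : ∀ {p q r} → p ≈ₚ q → q ≈ₚ r → p ≈ₚ r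

    ⊕-cong : ∀ {p p′ q q′} → p ≈ₚ p′ → q ≈ₚ q′ → p ⊕ q ≈ₚ p′ ⊕ q′
    ⊛-cong : ∀ {p p′ q q′} → p ≈ₚ p′ → q ≈ₚ q′ → p ⊛ q ≈ₚ p′ ⊛ q′

    ⊕-assoc     : ∀ p q r → (p ⊕ q) ⊕ r ≈ₚ p ⊕ (q ⊕ r)
    ⊕-comm      : ∀ p q → p ⊕ q ≈ₚ q ⊕ p
    ⊕-identityˡ : ∀ p → con K.0# ⊕ p ≈ₚ p
    ⊛-assoc     : ∀ p q r → (p ⊛ q) ⊛ r ≈ₚ p ⊛ (q ⊛ r)
    ⊛-comm      : ∀ p q → p ⊛ q ≈ₚ q ⊛ p
    ⊛-identityˡ : ∀ p → con K.1# ⊛ p ≈ₚ p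
    ⊛-zeroˡ     : ∀ p → con K.0# ⊛ p ≈ₚ con K.0#
    ⊛-distribˡ  : ∀ p q r → p ⊛ (q ⊕ r) ≈ₚ p ⊛ q ⊕ p ⊛ r

    con-cong : ∀ {k l} → k K.≈ l → con k ≈ₚ con l
    con-+    : ∀ k l → con (k K.+ l) ≈ₚ con k ⊕ con l
    con-*    : ∀ k l → con (k K.* l) ≈ₚ con k ⊛ con l

  ⊛-distribʳ : ∀ p q r → (q ⊕ r) ⊛ p ≈ₚ q ⊛ p ⊕ r ⊛ p
  ⊛-distribʳ p q r = ≈-trans (⊛-comm _ p)
    (≈-trans (⊛-distribˡ p q r) (⊕-cong (⊛-comm p q) (⊛-comm p r)))

  -1⊛-inverseˡ : ∀ p → con (K.- K.1#) ⊛ p ⊕ p ≈ₚ con K.0#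
  -1⊛-inverseˡ p =
    ≈-trans (⊕-cong ≈-refl (≈-sym (⊛-identityˡ p)))
    (≈-trans (≈-sym (⊛-distribʳ p _ _))
    (≈-trans (⊛-cong (≈-trans (≈-sym (con-+ _ _)) (con-cong (K.-‿inverseˡ K.1#))) ≈-refl)
             (⊛-zeroˡ p)))

  ≈-isEquivalence : IsEquivalence _≈ₚ_
  ≈-isEquivalence = record { refl = ≈-refl ; sym = ≈-sym ; trans = ≈-trans }

  commutativeRing : CommutativeRing c (c ⊔ ℓ)
  commutativeRing = record
    { Carrier = Polynomial
    ; _≈_     = _≈ₚ_
    ; _+_     = _⊕_
    ; _*_     = _⊛_
    ; -_      = con (K.- K.1#) ⊛_
    ; 0#      = con K.0#
    ; 1#      = con K.1#
    ; isCommutativeRing = record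
      { isRing = record
        { +-isAbelianGroup = record
          { isGroup = record
            { isMonoid = record
              { isSemigroup = record
                { isMagma = record { isEquivalence = ≈-isEquivalence ; ∙-cong = ⊕-cong }
                ; assoc   = ⊕-assoc
                }
              ; identity = ⊕-identityˡ , λ p → ≈-trans (⊕-comm p _) (⊕-identityˡ p)
              }
            ; inverse = -1⊛-inverseˡ , λ p → ≈-trans (⊕-comm p _) (-1⊛-inverseˡ p)
            ; ⁻¹-cong = ⊛-cong ≈-refl
            }
          ; comm = ⊕-comm
          }
        ; *-cong     = ⊛-cong
        ; *-assoc    = ⊛-assoc
        ; *-identity = ⊛-identityˡ , λ p → ≈-trans (⊛-comm p _) (⊛-identityˡ p)
        ; distrib    = ⊛-distribˡ , ⊛-distribʳ
        }
      ; *-comm = ⊛-comm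
      }
    }

  K-module : Module K c (c ⊔ ℓ)
  K-module = record
    { Carrierᴹ = Polynomial
    ; _≈ᴹ_     = _≈ₚ_
    ; _+ᴹ_     = _⊕_
    ; _*ₗ_     = λ k p → con k ⊛ p
    ; _*ᵣ_     = λ p k → con k ⊛ p
    ; 0ᴹ       = con K.0#
    ; -ᴹ_      = con (K.- K.1#) ⊛_
    ; isModule = IsModuleFromLeft.isModule {commutativeRing = K} record
      { isLeftModule = record
        { isLeftSemimodule = record
          { +ᴹ-isCommutativeMonoid = P.+-isCommutativeMonoid
          ; isPreleftSemimodule = record
            { *ₗ-cong      = λ k≈l p≈q → ⊛-cong (con-cong k≈l) p≈q
            ; *ₗ-zeroˡ     = ⊛-zeroˡ
            ; *ₗ-distribʳ  = λ p k l → ≈-trans (⊛-cong (con-+ k l) ≈-refl) (⊛-distribʳ p _ _)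
            ; *ₗ-identityˡ = ⊛-identityˡ
            ; *ₗ-assoc     = λ k l p → ≈-trans (⊛-cong (con-* k l) ≈-refl) (⊛-assoc _ _ p)
            ; *ₗ-zeroʳ     = λ k → P.zeroʳ (con k)
            ; *ₗ-distribˡ  = λ k → ⊛-distribˡ (con k)
            }
          }
        ; -ᴹ‿cong    = P.-‿cong
        ; -ᴹ‿inverse = P.-‿inverse
        }
      }
    }
    where module P = CommutativeRing commutativeRing

  module Evaluation {r ℓr} (R : CommutativeRing r ℓr) (φ : K.Carrier → CommutativeRing.Carrier R)
                    (ρ : I → CommutativeRing.Carrier R) where

    private
      module R = CommutativeRing R

    eval : Polynomial → R.Carrier
    eval (con k) = φ k
    eval (var i) = ρ i
    eval (p ⊕ q) = eval p R.+ eval q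
    eval (p ⊛ q) = eval p R.* eval q

    module _ (φ-hom : RingMorphisms.IsRingHomomorphism K.rawRing R.rawRing φ) where

      private
        module φ = RingMorphisms.IsRingHomomorphism φ-hom

      eval-cong : ∀ {p q} → p ≈ₚ q → eval p R.≈ eval q
      eval-cong ≈-refl             = R.refl
      eval-cong (≈-sym e)          = R.sym (eval-cong e)
      eval-cong (≈-trans e f)      = R.trans (eval-cong e) (eval-cong f)
      eval-cong (⊕-cong e f)       = R.+-cong (eval-cong e) (eval-cong f)
      eval-cong (⊛-cong e f)       = R.*-cong (eval-cong e) (eval-cong f)
      eval-cong (⊕-assoc p q r)    = R.+-assoc _ _ _
      eval-cong (⊕-comm p q)       = R.+-comm _ _
      eval-cong (⊕-identityˡ p)    = R.trans (R.+-congʳ φ.0#-homo) (R.+-identityˡ _)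
      eval-cong (⊛-assoc p q r)    = R.*-assoc _ _ _
      eval-cong (⊛-comm p q)       = R.*-comm _ _
      eval-cong (⊛-identityˡ p)    = R.trans (R.*-congʳ φ.1#-homo) (R.*-identityˡ _)
      eval-cong (⊛-zeroˡ p)        =
        R.trans (R.*-congʳ φ.0#-homo) (R.trans (R.zeroˡ _) (R.sym φ.0#-homo))
      eval-cong (⊛-distribˡ p q r) = R.distribˡ _ _ _
      eval-cong (con-cong e)       = φ.⟦⟧-cong e
      eval-cong (con-+ k l)        = φ.+-homo k l
      eval-cong (con-* k l)        = φ.*-homo k l

      eval-isRingHomomorphism :
        RingMorphisms.IsRingHomomorphism (CommutativeRing.rawRing commutativeRing) R.rawRing eval
      eval-isRingHomomorphism = record
        { isSemiringHomomorphism = record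
          { isNearSemiringHomomorphism = record
            { +-isMonoidHomomorphism = record
              { isMagmaHomomorphism = record
                { isRelHomomorphism = record { cong = eval-cong }
                ; homo              = λ _ _ → R.refl
                }
              ; ε-homo = φ.0#-homo
              }
            ; *-homo = λ _ _ → R.refl
            }
          ; 1#-homo = φ.1#-homo
          }
        ; -‿homo = λ p → R.trans
            (R.*-congʳ (R.trans (φ.-‿homo K.1#) (R.-‿cong φ.1#-homo)))
            (RingProperties.-1*x≈-x R.ring (eval p))
        }

------------------------------------------------------------------------
-- Tensor products

module TensorProduct {c ℓ a ℓa b ℓb} {K : CommutativeRing c ℓ}
                     (A : Module K a ℓa) (B : Module K b ℓb) where

  private
    module K = CommutativeRing K
    module A = Module A
    module B = Module B

  infixl 6 _+ₜ_
  infix  7 _⊗_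
  infix  4 _≈ₜ_

  -- Finite sums of pure tensors, modulo bilinearity.
  data Tensor : Set (a ⊔ b) where
    0ₜ   : Tensor
    _+ₜ_ : Tensor → Tensor → Tensor
    _⊗_  : A.Carrierᴹ → B.Carrierᴹ → Tensor

  data _≈ₜ_ : Tensor → Tensor → Set (c ⊔ a ⊔ ℓa ⊔ b ⊔ ℓb) where
    ≈ₜ-refl  : ∀ {s} → s ≈ₜ s
    ≈ₜ-sym   : ∀ {s t} → s ≈ₜ t → t ≈ₜ s
    ≈ₜ-trans : ∀ {s t u} → s ≈ₜ t → t ≈ₜ u → s ≈ₜ u

    +ₜ-cong      : ∀ {s s′ t t′} → s ≈ₜ s′ → t ≈ₜ t′ → s +ₜ t ≈ₜ s′ +ₜ t′
    +ₜ-assoc     : ∀ s t u → (s +ₜ t) +ₜ u ≈ₜ s +ₜ (t +ₜ u)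
    +ₜ-comm      : ∀ s t → s +ₜ t ≈ₜ t +ₜ s
    +ₜ-identityˡ : ∀ s → 0ₜ +ₜ s ≈ₜ s

    ⊗-cong     : ∀ {x x′ y y′} → x A.≈ᴹ x′ → y B.≈ᴹ y′ → x ⊗ y ≈ₜ x′ ⊗ y′
    ⊗-zeroˡ    : ∀ y → A.0ᴹ ⊗ y ≈ₜ 0ₜ
    ⊗-zeroʳ    : ∀ x → x ⊗ B.0ᴹ ≈ₜ 0ₜ
    ⊗-+ˡ       : ∀ x x′ y → (x A.+ᴹ x′) ⊗ y ≈ₜ x ⊗ y +ₜ x′ ⊗ y
    ⊗-+ʳ       : ∀ x y y′ → x ⊗ (y B.+ᴹ y′) ≈ₜ x ⊗ y +ₜ x ⊗ y′
    ⊗-balanced : ∀ k x y → (k A.*ₗ x) ⊗ y ≈ₜ x ⊗ (k B.*ₗ y)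

  ≈ₜ-isEquivalence : IsEquivalence _≈ₜ_
  ≈ₜ-isEquivalence = record { refl = ≈ₜ-refl ; sym = ≈ₜ-sym ; trans = ≈ₜ-trans }

  +ₜ-commutativeMonoid : CommutativeMonoid (a ⊔ b) (c ⊔ a ⊔ ℓa ⊔ b ⊔ ℓb)
  +ₜ-commutativeMonoid = record
    { Carrier = Tensor
    ; _≈_     = _≈ₜ_
    ; _∙_     = _+ₜ_
    ; ε       = 0ₜ
    ; isCommutativeMonoid = record
      { isMonoid = record
        { isSemigroup = record
          { isMagma = record { isEquivalence = ≈ₜ-isEquivalence ; ∙-cong = +ₜ-cong }
          ; assoc   = +ₜ-assoc
          }
        ; identity = +ₜ-identityˡ , λ s → ≈ₜ-trans (+ₜ-comm s 0ₜ) (+ₜ-identityˡ s)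
        }
      ; comm = +ₜ-comm
      }
    }

  module _ {r ℓr} (M : CommutativeMonoid r ℓr) where

    private
      module M = CommutativeMonoid M

    record IsBilinear (f : A.Carrierᴹ → B.Carrierᴹ → M.Carrier) : Set (c ⊔ a ⊔ ℓa ⊔ b ⊔ ℓb ⊔ ℓr) where
      field
        cong     : ∀ {x x′ y y′} → x A.≈ᴹ x′ → y B.≈ᴹ y′ → f x y M.≈ f x′ y′
        zeroˡ    : ∀ y → f A.0ᴹ y M.≈ M.ε
        zeroʳ    : ∀ x → f x B.0ᴹ M.≈ M.ε
        +ˡ       : ∀ x x′ y → f (x A.+ᴹ x′) y M.≈ f x y M.∙ f x′ y
        +ʳ       : ∀ x y y′ → f x (y B.+ᴹ y′) M.≈ f x y M.∙ f x y′
        balanced : ∀ k x y → f (k A.*ₗ x) y M.≈ f x (k B.*ₗ y)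

    -- The additive map A ⊗ B → M induced by a bilinear f.
    lift : (A.Carrierᴹ → B.Carrierᴹ → M.Carrier) → Tensor → M.Carrier
    lift f 0ₜ       = M.ε
    lift f (s +ₜ t) = lift f s M.∙ lift f t
    lift f (x ⊗ y)  = f x y

    lift-cong : ∀ {f} → IsBilinear f → ∀ {s t} → s ≈ₜ t → lift f s M.≈ lift f t
    lift-cong {f} bilinear = go
      where
      module f = IsBilinear bilinear

      go : ∀ {s t} → s ≈ₜ t → lift f s M.≈ lift f t
      go ≈ₜ-refl            = M.refl
      go (≈ₜ-sym e)         = M.sym (go e)
      go (≈ₜ-trans e e′)    = M.trans (go e) (go e′)
      go (+ₜ-cong e e′)     = M.∙-cong (go e) (go e′)
      go (+ₜ-assoc s t u)   = M.assoc _ _ _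
      go (+ₜ-comm s t)      = M.comm _ _
      go (+ₜ-identityˡ s)   = M.identityˡ _
      go (⊗-cong e e′)      = f.cong e e′
      go (⊗-zeroˡ y)        = f.zeroˡ y
      go (⊗-zeroʳ x)        = f.zeroʳ x
      go (⊗-+ˡ x x′ y)      = f.+ˡ x x′ y
      go (⊗-+ʳ x y y′)      = f.+ʳ x y y′
      go (⊗-balanced k x y) = f.balanced k x y

module TensorSquare {c ℓ} (K : CommutativeRing c ℓ) (I : Set) where

  open Polynomials K I
  open TensorProduct K-module K-module public

  private
    module K = CommutativeRing K
    module P = CommutativeRing commutativeRing

    swap : ∀ p q r → p ⊛ (q ⊛ r) ≈ₚ q ⊛ (p ⊛ r)
    swap = CommutativeSemigroupProperties.x∙yz≈y∙xz P.*-commutativeSemigroup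

    interchange : ∀ s t u v → (s +ₜ t) +ₜ (u +ₜ v) ≈ₜ (s +ₜ u) +ₜ (t +ₜ v)
    interchange = CommutativeSemigroupProperties.interchange
      (CommutativeMonoid.commutativeSemigroup +ₜ-commutativeMonoid)

  infixl 7 _*ₜ_

  pureTimes : Polynomial → Polynomial → Tensor → Tensor
  pureTimes x y = lift +ₜ-commutativeMonoid (λ x′ y′ → (x ⊛ x′) ⊗ (y ⊛ y′))

  -- (x ⊗ y) (x′ ⊗ y′) = x x′ ⊗ y y′
  _*ₜ_ : Tensor → Tensor → Tensor
  s *ₜ t = lift +ₜ-commutativeMonoid (λ x y → pureTimes x y t) s

  1ₜ : Tensor
  1ₜ = con K.1# ⊗ con K.1#

  private
    pureTimes-congʳ : ∀ x y {s t} → s ≈ₜ t → pureTimes x y s ≈ₜ pureTimes x y t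
    pureTimes-congʳ x y = lift-cong +ₜ-commutativeMonoid record
      { cong     = λ e e′ → ⊗-cong (P.*-congˡ e) (P.*-congˡ e′)
      ; zeroˡ    = λ _ → ≈ₜ-trans (⊗-cong (P.zeroʳ x) P.refl) (⊗-zeroˡ _)
      ; zeroʳ    = λ _ → ≈ₜ-trans (⊗-cong P.refl (P.zeroʳ y)) (⊗-zeroʳ _)
      ; +ˡ       = λ _ _ _ → ≈ₜ-trans (⊗-cong (P.distribˡ x _ _) P.refl) (⊗-+ˡ _ _ _)
      ; +ʳ       = λ _ _ _ → ≈ₜ-trans (⊗-cong P.refl (P.distribˡ y _ _)) (⊗-+ʳ _ _ _)
      ; balanced = λ k _ _ → ≈ₜ-trans (⊗-cong (swap x (con k) _) P.refl)
                     (≈ₜ-trans (⊗-balanced k _ _) (⊗-cong P.refl (swap (con k) y _)))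
      }

    pureTimes-cong : ∀ {x x′ y y′} → x ≈ₚ x′ → y ≈ₚ y′ → ∀ t → pureTimes x y t ≈ₜ pureTimes x′ y′ t
    pureTimes-cong e e′ 0ₜ       = ≈ₜ-refl
    pureTimes-cong e e′ (s +ₜ t) = +ₜ-cong (pureTimes-cong e e′ s) (pureTimes-cong e e′ t)
    pureTimes-cong e e′ (u ⊗ v)  = ⊗-cong (P.*-congʳ e) (P.*-congʳ e′)

    pureTimes-zeroˡ : ∀ y t → pureTimes P.0# y t ≈ₜ 0ₜ
    pureTimes-zeroˡ y 0ₜ       = ≈ₜ-refl
    pureTimes-zeroˡ y (s +ₜ t) =
      ≈ₜ-trans (+ₜ-cong (pureTimes-zeroˡ y s) (pureTimes-zeroˡ y t)) (+ₜ-identityˡ _)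
    pureTimes-zeroˡ y (u ⊗ v)  = ≈ₜ-trans (⊗-cong (P.zeroˡ u) P.refl) (⊗-zeroˡ _)

    pureTimes-zeroʳ : ∀ x t → pureTimes x P.0# t ≈ₜ 0ₜ
    pureTimes-zeroʳ x 0ₜ       = ≈ₜ-refl
    pureTimes-zeroʳ x (s +ₜ t) =
      ≈ₜ-trans (+ₜ-cong (pureTimes-zeroʳ x s) (pureTimes-zeroʳ x t)) (+ₜ-identityˡ _)
    pureTimes-zeroʳ x (u ⊗ v)  = ≈ₜ-trans (⊗-cong P.refl (P.zeroˡ v)) (⊗-zeroʳ _)

    pureTimes-+ˡ : ∀ x x′ y t → pureTimes (x ⊕ x′) y t ≈ₜ pureTimes x y t +ₜ pureTimes x′ y t
    pureTimes-+ˡ x x′ y 0ₜ       = ≈ₜ-sym (+ₜ-identityˡ _)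
    pureTimes-+ˡ x x′ y (s +ₜ t) =
      ≈ₜ-trans (+ₜ-cong (pureTimes-+ˡ x x′ y s) (pureTimes-+ˡ x x′ y t)) (interchange _ _ _ _)
    pureTimes-+ˡ x x′ y (u ⊗ v)  = ≈ₜ-trans (⊗-cong (P.distribʳ u x x′) P.refl) (⊗-+ˡ _ _ _)

    pureTimes-+ʳ : ∀ x y y′ t → pureTimes x (y ⊕ y′) t ≈ₜ pureTimes x y t +ₜ pureTimes x y′ t
    pureTimes-+ʳ x y y′ 0ₜ       = ≈ₜ-sym (+ₜ-identityˡ _)
    pureTimes-+ʳ x y y′ (s +ₜ t) =
      ≈ₜ-trans (+ₜ-cong (pureTimes-+ʳ x y y′ s) (pureTimes-+ʳ x y y′ t)) (interchange _ _ _ _)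
    pureTimes-+ʳ x y y′ (u ⊗ v)  = ≈ₜ-trans (⊗-cong P.refl (P.distribʳ v y y′)) (⊗-+ʳ _ _ _)

    pureTimes-balanced : ∀ k x y t → pureTimes (con k ⊛ x) y t ≈ₜ pureTimes x (con k ⊛ y) t
    pureTimes-balanced k x y 0ₜ       = ≈ₜ-refl
    pureTimes-balanced k x y (s +ₜ t) =
      +ₜ-cong (pureTimes-balanced k x y s) (pureTimes-balanced k x y t)
    pureTimes-balanced k x y (u ⊗ v)  = ≈ₜ-trans (⊗-cong (P.*-assoc _ x u) P.refl)
      (≈ₜ-trans (⊗-balanced k _ _) (⊗-cong P.refl (P.sym (P.*-assoc _ y v))))

    *ₜ-congʳ : ∀ t {s s′} → s ≈ₜ s′ → s *ₜ t ≈ₜ s′ *ₜ t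
    *ₜ-congʳ t = lift-cong +ₜ-commutativeMonoid record
      { cong     = λ e e′ → pureTimes-cong e e′ t
      ; zeroˡ    = λ y → pureTimes-zeroˡ y t
      ; zeroʳ    = λ x → pureTimes-zeroʳ x t
      ; +ˡ       = λ x x′ y → pureTimes-+ˡ x x′ y t
      ; +ʳ       = λ x y y′ → pureTimes-+ʳ x y y′ t
      ; balanced = λ k x y → pureTimes-balanced k x y t
      }

    *ₜ-congˡ : ∀ s {t t′} → t ≈ₜ t′ → s *ₜ t ≈ₜ s *ₜ t′
    *ₜ-congˡ 0ₜ        e = ≈ₜ-refl
    *ₜ-congˡ (s +ₜ s′) e = +ₜ-cong (*ₜ-congˡ s e) (*ₜ-congˡ s′ e)
    *ₜ-congˡ (x ⊗ y)   e = pureTimes-congʳ x y e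

    *ₜ-zeroʳ : ∀ s → s *ₜ 0ₜ ≈ₜ 0ₜ
    *ₜ-zeroʳ 0ₜ        = ≈ₜ-refl
    *ₜ-zeroʳ (s +ₜ s′) = ≈ₜ-trans (+ₜ-cong (*ₜ-zeroʳ s) (*ₜ-zeroʳ s′)) (+ₜ-identityˡ _)
    *ₜ-zeroʳ (x ⊗ y)   = ≈ₜ-refl

    *ₜ-distribˡ : ∀ s t u → s *ₜ (t +ₜ u) ≈ₜ s *ₜ t +ₜ s *ₜ u
    *ₜ-distribˡ 0ₜ        t u = ≈ₜ-sym (+ₜ-identityˡ _)
    *ₜ-distribˡ (s +ₜ s′) t u =
      ≈ₜ-trans (+ₜ-cong (*ₜ-distribˡ s t u) (*ₜ-distribˡ s′ t u)) (interchange _ _ _ _)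
    *ₜ-distribˡ (x ⊗ y)   t u = ≈ₜ-refl

    *ₜ-comm : ∀ s t → s *ₜ t ≈ₜ t *ₜ s
    *ₜ-comm 0ₜ        t        = ≈ₜ-sym (*ₜ-zeroʳ t)
    *ₜ-comm (s +ₜ s′) t        =
      ≈ₜ-trans (+ₜ-cong (*ₜ-comm s t) (*ₜ-comm s′ t)) (≈ₜ-sym (*ₜ-distribˡ t s s′))
    *ₜ-comm (x ⊗ y) 0ₜ         = ≈ₜ-refl
    *ₜ-comm (x ⊗ y) (t +ₜ t′)  = +ₜ-cong (*ₜ-comm (x ⊗ y) t) (*ₜ-comm (x ⊗ y) t′)
    *ₜ-comm (x ⊗ y) (x′ ⊗ y′)  = ⊗-cong (P.*-comm x x′) (P.*-comm y y′)

    *ₜ-assoc : ∀ s t u → (s *ₜ t) *ₜ u ≈ₜ s *ₜ (t *ₜ u)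
    *ₜ-assoc 0ₜ        t u = ≈ₜ-refl
    *ₜ-assoc (s +ₜ s′) t u = +ₜ-cong (*ₜ-assoc s t u) (*ₜ-assoc s′ t u)
    *ₜ-assoc (x ⊗ y) 0ₜ        u = ≈ₜ-refl
    *ₜ-assoc (x ⊗ y) (t +ₜ t′) u = +ₜ-cong (*ₜ-assoc (x ⊗ y) t u) (*ₜ-assoc (x ⊗ y) t′ u)
    *ₜ-assoc (x ⊗ y) (x′ ⊗ y′) 0ₜ        = ≈ₜ-refl
    *ₜ-assoc (x ⊗ y) (x′ ⊗ y′) (u +ₜ u′) =
      +ₜ-cong (*ₜ-assoc (x ⊗ y) (x′ ⊗ y′) u) (*ₜ-assoc (x ⊗ y) (x′ ⊗ y′) u′)
    *ₜ-assoc (x ⊗ y) (x′ ⊗ y′) (x″ ⊗ y″) = ⊗-cong (P.*-assoc x x′ x″) (P.*-assoc y y′ y″)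

    *ₜ-identityˡ : ∀ s → 1ₜ *ₜ s ≈ₜ s
    *ₜ-identityˡ 0ₜ        = ≈ₜ-refl
    *ₜ-identityˡ (s +ₜ s′) = +ₜ-cong (*ₜ-identityˡ s) (*ₜ-identityˡ s′)
    *ₜ-identityˡ (x ⊗ y)   = ⊗-cong (P.*-identityˡ x) (P.*-identityˡ y)

  scalar : K.Carrier → Tensor
  scalar k = con k ⊗ con K.1#

  private
    -ₜ-inverseˡ : ∀ s → scalar (K.- K.1#) *ₜ s +ₜ s ≈ₜ 0ₜ
    -ₜ-inverseˡ s =
      ≈ₜ-trans (+ₜ-cong ≈ₜ-refl (≈ₜ-sym (*ₜ-identityˡ s)))
      (≈ₜ-trans (*ₜ-congʳ s {scalar (K.- K.1#) +ₜ 1ₜ}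
        (≈ₜ-trans (≈ₜ-sym (⊗-+ˡ _ _ _))
        (≈ₜ-trans (⊗-cong (≈-trans (≈-sym (con-+ _ _)) (con-cong (K.-‿inverseˡ K.1#))) P.refl)
                  (⊗-zeroˡ _))))
      ≈ₜ-refl)

  tensorRing : CommutativeRing c (c ⊔ ℓ)
  tensorRing = record
    { Carrier = Tensor
    ; _≈_     = _≈ₜ_
    ; _+_     = _+ₜ_
    ; _*_     = _*ₜ_
    ; -_      = scalar (K.- K.1#) *ₜ_
    ; 0#      = 0ₜ
    ; 1#      = 1ₜ
    ; isCommutativeRing = record
      { isRing = record
        { +-isAbelianGroup = record
          { isGroup = record
            { isMonoid = CommutativeMonoid.isMonoid +ₜ-commutativeMonoid
            ; inverse  = -ₜ-inverseˡ , λ s → ≈ₜ-trans (+ₜ-comm s _) (-ₜ-inverseˡ s)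
            ; ⁻¹-cong  = *ₜ-congˡ (scalar (K.- K.1#))
            }
          ; comm = +ₜ-comm
          }
        ; *-cong     = λ {s} {s′} {t} e e′ → ≈ₜ-trans (*ₜ-congʳ t e) (*ₜ-congˡ s′ e′)
        ; *-assoc    = *ₜ-assoc
        ; *-identity = *ₜ-identityˡ , λ s → ≈ₜ-trans (*ₜ-comm s 1ₜ) (*ₜ-identityˡ s)
        ; distrib    = *ₜ-distribˡ , λ _ _ _ → ≈ₜ-refl
        }
      ; *-comm = *ₜ-comm
      }
    }

  scalar-isRingHomomorphism :
    RingMorphisms.IsRingHomomorphism K.rawRing (CommutativeRing.rawRing tensorRing) scalar
  scalar-isRingHomomorphism = record
    { isSemiringHomomorphism = record
      { isNearSemiringHomomorphism = record
        { +-isMonoidHomomorphism = record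
          { isMagmaHomomorphism = record
            { isRelHomomorphism = record { cong = λ e → ⊗-cong (con-cong e) P.refl }
            ; homo              = λ k l → ≈ₜ-trans (⊗-cong (con-+ k l) P.refl) (⊗-+ˡ _ _ _)
            }
          ; ε-homo = ⊗-zeroˡ _
          }
        ; *-homo = λ k l → ⊗-cong (con-* k l) (P.sym (P.*-identityˡ _))
        }
      ; 1#-homo = ≈ₜ-refl
      }
    ; -‿homo = λ k → ⊗-cong
        (≈-trans (con-cong (K.sym (RingProperties.-1*x≈-x K.ring k))) (con-* _ k))
        (P.sym (P.*-identityˡ _))
    }

------------------------------------------------------------------------
-- The Hopf algebra

-- The index set ⊔ₙ (NC n ∖ {1ₙ}).  Since NC 0 = {𝟙 0}, there is no index
-- with size 0.
record Index : Set where
  constructor index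
  field
    size        : ℕ
    partition   : NC size
    .nontrivial : partition ≢ 𝟙 size

module HopfAlgebra {c ℓ} (K : CommutativeRing c ℓ) where

  private
    module K = CommutativeRing K

  open Polynomials K Index public using (con; var)
  open Polynomials K Index using (commutativeRing; K-module; module Evaluation)
  open TensorSquare K Index public

  open CommutativeRing commutativeRing public
    renaming (Carrier to 𝒯) using (_≈_; _+_; _*_; -_; 0#; 1#)
  open RawSemiringDefs (RawRing.rawSemiring (CommutativeRing.rawRing commutativeRing)) public using (_^_)

  private
    module T⊗T = CommutativeRing tensorRing

  X : NC n → 𝒯
  X {n} π with π ≟ 𝟙 n
  ... | yes _  = 1#
  ... | no π≢𝟙 = var (index n π π≢𝟙)

  M : NC n → NC n → 𝒯
  M π σ = foldr _*_ 1# (map (λ W → X (restrict π W)) (blocks σ))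

  productFrom : NC n → List (NC n) → 𝒯
  productFrom π []       = 1#
  productFrom π (ρ ∷ ρs) = M π ρ * productFrom ρ ρs

  -- M_c for the chain c = (π₀, …, πₖ).
  Mᶜ : Tuple n → 𝒯
  Mᶜ c = productFrom (List⁺.head c) (List⁺.tail c)

  Δ-generator : Index → Tensor
  Δ-generator (index n π _) =
    foldr _+ₜ_ 0ₜ (map (λ σ → M π σ ⊗ X σ) (filter (π ≤?_) (allNC n)))

  Δ : 𝒯 → Tensor
  Δ = Evaluation.eval tensorRing scalar Δ-generator

  Δ-isRingHomomorphism :
    RingMorphisms.IsRingHomomorphism (CommutativeRing.rawRing commutativeRing) T⊗T.rawRing Δ
  Δ-isRingHomomorphism =
    Evaluation.eval-isRingHomomorphism tensorRing scalar Δ-generator scalar-isRingHomomorphism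

  ε : 𝒯 → K.Carrier
  ε = Evaluation.eval K id (λ _ → K.0#)

  ε-isRingHomomorphism :
    RingMorphisms.IsRingHomomorphism (CommutativeRing.rawRing commutativeRing) K.rawRing ε
  ε-isRingHomomorphism =
    Evaluation.eval-isRingHomomorphism K id (λ _ → K.0#)
      (RingIdentity.isRingHomomorphism K.rawRing K.refl)

  _⊗₁_ : (𝒯 → 𝒯) → (𝒯 → 𝒯) → Tensor → Tensor
  F ⊗₁ G = lift +ₜ-commutativeMonoid (λ x y → F x ⊗ G y)

  multiply : Tensor → 𝒯
  multiply = lift (CommutativeRing.+-commutativeMonoid commutativeRing) _*_

  _∗_ : (𝒯 → 𝒯) → (𝒯 → 𝒯) → 𝒯 → 𝒯
  F ∗ G = multiply ∘ (F ⊗₁ G) ∘ Δ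

  IsLinear : (𝒯 → 𝒯) → Set (c ⊔ ℓ)
  IsLinear = ModuleMorphisms.IsModuleHomomorphism rawModule rawModule
    where rawModule = Module.rawModule K-module

  ∗-cong : ∀ {F G} → IsLinear F → IsLinear G → ∀ {p q} → p ≈ q → (F ∗ G) p ≈ (F ∗ G) q
  ∗-cong F-linear G-linear p≈q =
    lift-cong (CommutativeRing.+-commutativeMonoid commutativeRing) record
      { cong     = T.*-cong
      ; zeroˡ    = T.zeroˡ
      ; zeroʳ    = T.zeroʳ
      ; +ˡ       = λ x x′ y → T.distribʳ y x x′
      ; +ʳ       = T.distribˡ
      ; balanced = λ k x y → T.trans (T.*-congʳ (T.*-comm (con k) x)) (T.*-assoc x (con k) y)
      }
    (lift-cong +ₜ-commutativeMonoid record
      { cong     = λ e e′ → ⊗-cong (F.⟦⟧-cong e) (G.⟦⟧-cong e′)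
      ; zeroˡ    = λ _ → ≈ₜ-trans (⊗-cong F.0ᴹ-homo T.refl) (⊗-zeroˡ _)
      ; zeroʳ    = λ _ → ≈ₜ-trans (⊗-cong T.refl G.0ᴹ-homo) (⊗-zeroʳ _)
      ; +ˡ       = λ _ _ _ → ≈ₜ-trans (⊗-cong (F.+ᴹ-homo _ _) T.refl) (⊗-+ˡ _ _ _)
      ; +ʳ       = λ _ _ _ → ≈ₜ-trans (⊗-cong T.refl (G.+ᴹ-homo _ _)) (⊗-+ʳ _ _ _)
      ; balanced = λ k _ _ → ≈ₜ-trans (⊗-cong (F.*ₗ-homo k _) T.refl)
                     (≈ₜ-trans (⊗-balanced k _ _) (⊗-cong T.refl (T.sym (G.*ₗ-homo k _))))
      }
    (RingMorphisms.IsRingHomomorphism.⟦⟧-cong Δ-isRingHomomorphism p≈q))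
    where
    module T = CommutativeRing commutativeRing
    module F = ModuleMorphisms.IsModuleHomomorphism F-linear
    module G = ModuleMorphisms.IsModuleHomomorphism G-linear

  record IsAntipode (S : 𝒯 → 𝒯) : Set (c ⊔ ℓ) where
    field
      isLinear : IsLinear S
      inverseˡ : ∀ p → (S ∗ id) p ≈ con (ε p) * 1#
      inverseʳ : ∀ p → (id ∗ S) p ≈ con (ε p) * 1#

  sum : List 𝒯 → 𝒯
  sum = foldr _+_ 0#

{-# OPTIONS --safe #-}

-- The equation (id ∗ S)(X π) = 0 reads Σ_{σ ≥ π} M π σ · S (X σ) = 0, and
-- together with S 1 = 1 it determines every S (X π), by induction from the
-- top of NC n.  So it suffices that the sums g τ σ of the signed weights of
-- the efficient chains from τ to σ satisfy Σ_{π ≤ τ ≤ σ} M π τ · g τ σ = 0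
-- for π < σ.  This is proved by induction on σ in a refined form: if τ is
-- required to have a given set D of blocks of σ among its blocks, then the
-- sum is M π σ when D contains all the blocks of σ that are not blocks of π,
-- and 0 otherwise.

module Submission where

open import Defs
open import Algebra.Bundles using (CommutativeMonoid; CommutativeRing)
import Algebra.Properties.CommutativeSemigroup as CommutativeSemigroupProperties
import Algebra.Properties.Ring as RingProperties
import Algebra.Properties.Semiring.Exp as SemiringExp
open import Data.Bool.Base using (true; false; if_then_else_)
open import Data.Empty using (⊥)
open import Data.Fin.Base as Fin using (Fin; zero; suc)
import Data.Fin.Properties as Fin
open import Data.Fin.Subset using (Subset; inside; outside; ∣_∣)
  renaming (_∈_ to _∈ₛ_; _∉_ to _∉ₛ_; _⊆_ to _⊆ₛ_)
import Data.Fin.Subset.Properties as Subset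
open import Data.List.Base as List
  using (List; []; _∷_; _++_; _∷ʳ_; map; filter; foldr; length; concatMap; last; initLast; _∷ʳ′_)
open import Data.List.Membership.Propositional using (_∈_)
open import Data.List.Membership.Propositional.Properties
open import Data.List.Membership.Propositional.Properties.WithK using (unique∧set⇒bag)
open import Data.List.NonEmpty.Base as List⁺ using (_∷_; toList)
import Data.List.Properties as List
open import Data.List.Relation.Binary.BagAndSetEquality using (∼bag⇒↭)
open import Data.List.Relation.Binary.Disjoint.Propositional using (Disjoint)
open import Data.List.Relation.Binary.Permutation.Propositional as Perm using (_↭_)
open import Data.List.Relation.Unary.All as All using (All; []; _∷_)
import Data.List.Relation.Unary.All.Properties as All
open import Data.List.Relation.Unary.AllPairs as AllPairs using (AllPairs; []; _∷_)
import Data.List.Relation.Unary.AllPairs.Properties as AllPairs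
open import Data.List.Relation.Unary.Any as Any using (Any; here; there)
import Data.List.Relation.Unary.Any.Properties as Any
open import Data.List.Relation.Unary.Linked using (Linked; []; [-]; _∷_)
import Data.List.Relation.Unary.Linked.Properties as Linked
open import Data.List.Relation.Unary.Unique.Propositional using (Unique)
import Data.List.Relation.Unary.Unique.Propositional.Properties as Unique
open import Data.Maybe.Base using (just)
import Data.Maybe.Properties as Maybe
open import Data.Maybe.Relation.Binary.Connected using (Connected; just)
open import Data.Nat.Base as ℕ using (ℕ; zero; suc; _≥_)
import Data.Nat.Induction as ℕ
import Data.Nat.Properties as ℕ
open import Data.Product using (_×_; _,_; proj₁; proj₂; ∃-syntax)
open import Data.Sum.Base using (_⊎_; inj₁; inj₂)
open import Data.Vec.Base as Vec using (Vec; lookup; tabulate; []; _∷_)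
import Data.Vec.Properties as Vec
open import Function.Base using (_∘_; id; flip)
open import Function.Bundles using (mk⇔; Equivalence)
open import Induction.WellFounded using (WellFounded; Acc; acc; module Subrelation)
open import Level using (Level)
import Relation.Binary.Construct.On as On
open import Relation.Binary.Core using (Rel)
open import Relation.Binary.Definitions using (Transitive; tri<; tri≈; tri>)
  renaming (Decidable to Decidable₂)
open import Relation.Binary.PropositionalEquality as ≡ using (_≡_; _≢_; refl)
import Relation.Binary.Reasoning.Setoid as ≈-Reasoning
open import Relation.Nullary using (¬_; Dec; yes; no; does; contradiction)
open import Relation.Nullary.Decidable
  using (map′; _×-dec_; _→-dec_; decidable-stable; ¬?; dec-true; dec-false)
open import Relation.Unary using (Pred; Decidable)

-- Finite sums over lists

-- Efficiency couples the two ends of a chain. Whether `σ` may follow `ρ` depends on the start,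
-- because a block common to `ρ` and `σ` is allowed only if the start already has it. So the plain
-- convolution does not reduce to shorter convolutions of the same form. Prescribing `D` makes the
-- induction close: once the last term `σ` is cut off, the start `τ` must contain the common blocks
-- of `ρ` and `σ`, which is again a sum of this kind, now ending at `ρ`. The same condition makes
-- the sign contributed by `σ` independent of `τ`. The induction hypothesis leaves only those `ρ`
-- whose blocks outside `π` are blocks of `σ`. For these the product of `M π ρ` and `M ρ σ` is
-- `M π σ`, which fails for general `ρ`. Only signs remain, and they cancel by toggling one block of
-- `σ`.

module BigOperator {c ℓ} (monoid : CommutativeMonoid c ℓ) where

  open CommutativeMonoid monoid renaming (refl to ≈-refl; sym to ≈-sym; trans to ≈-trans)
  open CommutativeSemigroupProperties commutativeSemigroup using (interchange)

  private
    variable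
      a p q : Level
      A B : Set a
      P : Set p
      Q : Set q

  ∑ : List A → (A → Carrier) → Carrier
  ∑ xs f = foldr _∙_ ε (map f xs)

  -- Side conditions sit in the summand while the range stays a fixed list. Sums whose conditions
  -- link both indices can then be interchanged by `∑-swap`.
  when : Dec P → Carrier → Carrier
  when P? x = if does P? then x else ε

  when-⇔ : (P? : Dec P) (Q? : Dec Q) → (P → Q) → (Q → P) →
           ∀ {x y} → (P → x ≈ y) → when P? x ≈ when Q? y
  when-⇔ (yes p) (yes q) to from x≈y = x≈y p
  when-⇔ (yes p) (no ¬q) to from x≈y = contradiction (to p) ¬q
  when-⇔ (no ¬p) (yes q) to from x≈y = contradiction (from q) ¬p
  when-⇔ (no ¬p) (no ¬q) to from x≈y = ≈-refl

  when-cong : (P? : Dec P) → ∀ {x y} → (P → x ≈ y) → when P? x ≈ when P? y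
  when-cong P? = when-⇔ P? P? id id

  when-no : (P? : Dec P) → ¬ P → ∀ {x} → when P? x ≈ ε
  when-no (yes p) ¬p = contradiction p ¬p
  when-no (no ¬p) _  = ≈-refl

  when-× : (P? : Dec P) (Q? : Dec Q) → ∀ {x} → when P? (when Q? x) ≈ when (P? ×-dec Q?) x
  when-× (yes _) (yes _) = ≈-refl
  when-× (yes _) (no _)  = ≈-refl
  when-× (no _)  _       = ≈-refl

  when-∙ : (P? : Dec P) → ∀ {x y} → when P? (x ∙ y) ≈ when P? x ∙ when P? y
  when-∙ (yes _) = ≈-refl
  when-∙ (no _)  = ≈-sym (identityˡ ε)

  when-split : (P? : Dec P) → ∀ {x} → x ≈ when P? x ∙ when (¬? P?) x
  when-split (yes _) = ≈-sym (identityʳ _)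
  when-split (no _)  = ≈-sym (identityˡ _)

  ∑-cong-∈ : (xs : List A) {f g : A → Carrier} → (∀ {x} → x ∈ xs → f x ≈ g x) → ∑ xs f ≈ ∑ xs g
  ∑-cong-∈ []       f≈g = ≈-refl
  ∑-cong-∈ (x ∷ xs) f≈g = ∙-cong (f≈g (here refl)) (∑-cong-∈ xs (f≈g ∘ there))

  ∑-cong : (xs : List A) {f g : A → Carrier} → (∀ x → f x ≈ g x) → ∑ xs f ≈ ∑ xs g
  ∑-cong xs f≈g = ∑-cong-∈ xs (λ {x} _ → f≈g x)

  ∑-ε : (xs : List A) → ∑ xs (λ _ → ε) ≈ ε
  ∑-ε []       = ≈-refl
  ∑-ε (x ∷ xs) = ≈-trans (identityˡ _) (∑-ε xs)

  ∑-∙ : (xs : List A) {f g : A → Carrier} → ∑ xs (λ x → f x ∙ g x) ≈ ∑ xs f ∙ ∑ xs g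
  ∑-∙ []       = ≈-sym (identityˡ ε)
  ∑-∙ (x ∷ xs) = ≈-trans (∙-congˡ (∑-∙ xs)) (interchange _ _ _ _)

  ∑-swap : (xs : List A) (ys : List B) {f : A → B → Carrier} →
           ∑ xs (λ x → ∑ ys (f x)) ≈ ∑ ys (λ y → ∑ xs (λ x → f x y))
  ∑-swap []       ys = ≈-sym (∑-ε ys)
  ∑-swap (x ∷ xs) ys = ≈-trans (∙-congˡ (∑-swap xs ys)) (≈-sym (∑-∙ ys))

  when-∑ : (P? : Dec P) (xs : List A) {f : A → Carrier} →
           when P? (∑ xs f) ≈ ∑ xs (λ x → when P? (f x))
  when-∑ (yes _) xs = ≈-refl
  when-∑ (no _)  xs = ≈-sym (∑-ε xs)

  ∑-filter : {P : Pred A p} (P? : Decidable P) (xs : List A) {f : A → Carrier} →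
             ∑ (filter P? xs) f ≈ ∑ xs (λ x → when (P? x) (f x))
  ∑-filter P? []       = ≈-refl
  ∑-filter P? (x ∷ xs) with does (P? x)
  ... | true  = ∙-congˡ (∑-filter P? xs)
  ... | false = ≈-trans (∑-filter P? xs) (≈-sym (identityˡ _))

  ∑-map : (h : A → B) (xs : List A) {f : B → Carrier} → ∑ (map h xs) f ≈ ∑ xs (f ∘ h)
  ∑-map h []       = ≈-refl
  ∑-map h (x ∷ xs) = ∙-congˡ (∑-map h xs)

  ∑-++ : (xs ys : List A) {f : A → Carrier} → ∑ (xs ++ ys) f ≈ ∑ xs f ∙ ∑ ys f
  ∑-++ []       ys = ≈-sym (identityˡ _)
  ∑-++ (x ∷ xs) ys = ≈-trans (∙-congˡ (∑-++ xs ys)) (≈-sym (assoc _ _ _))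

  ∑-concatMap : (h : A → List B) (xs : List A) {f : B → Carrier} →
                ∑ (concatMap h xs) f ≈ ∑ xs (λ x → ∑ (h x) f)
  ∑-concatMap h []       = ≈-refl
  ∑-concatMap h (x ∷ xs) = ≈-trans (∑-++ (h x) _) (∙-congˡ (∑-concatMap h xs))

  ∑-↭ : {xs ys : List A} {f : A → Carrier} → xs ↭ ys → ∑ xs f ≈ ∑ ys f
  ∑-↭ Perm.refl          = ≈-refl
  ∑-↭ (Perm.prep x p)    = ∙-congˡ (∑-↭ p)
  ∑-↭ {f = f} (Perm.swap {xs = xs} x y p) = ≈-trans (≈-sym (assoc _ _ _))
    (≈-trans (∙-cong (comm _ _) (∑-↭ {f = f} p)) (assoc _ _ _))
  ∑-↭ (Perm.trans p q)   = ≈-trans (∑-↭ p) (∑-↭ q)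

  ∑-unique : {xs ys : List A} {f : A → Carrier} → Unique xs → Unique ys →
             (∀ {z} → z ∈ xs → z ∈ ys) → (∀ {z} → z ∈ ys → z ∈ xs) → ∑ xs f ≈ ∑ ys f
  ∑-unique xs! ys! to from = ∑-↭ (∼bag⇒↭ (unique∧set⇒bag xs! ys! (mk⇔ to from)))

  ∑-single : {P : Pred A p} (P? : Decidable P) {xs : List A} {f : A → Carrier} → Unique xs →
             ∀ {y} → y ∈ xs → P y → (∀ {x} → P x → x ≡ y) → ∑ xs (λ x → when (P? x) (f x)) ≈ f y
  ∑-single P? {xs} xs! {y} y∈ Py P⇒≡ = ≈-trans (≈-sym (∑-filter P? xs))
    (≈-trans
      (∑-unique {ys = y ∷ []} (Unique.filter⁺ P? xs!) ([] ∷ [])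
        (λ z∈ → here (P⇒≡ (proj₂ (∈-filter⁻ P? {xs = xs} z∈))))
        (λ { (here refl) → ∈-filter⁺ P? y∈ Py }))
      (identityʳ _))

  -- The maps are total on `A` but need to be mutually inverse only between `P` and `Q`. The two
  -- gluing maps of `Toggle` are inverse only in this restricted sense.
  ∑-bijection : {P : Pred A p} {Q : Pred A q} (P? : Decidable P) (Q? : Decidable Q)
    {xs : List A} → Unique xs → (∀ x → x ∈ xs) → (to from : A → A) →
    (∀ {x} → P x → Q (to x) × from (to x) ≡ x) → (∀ {y} → Q y → P (from y) × to (from y) ≡ y) →
    {f : A → Carrier} → ∑ xs (λ y → when (Q? y) (f y)) ≈ ∑ xs (λ x → when (P? x) (f (to x)))
  ∑-bijection P? Q? {xs} xs! all to from P⇒Q Q⇒P =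
    ≈-trans (≈-sym (∑-filter Q? xs))
    (≈-trans (∑-unique {ys = map to (filter P? xs)} (Unique.filter⁺ Q? xs!) map!
      (λ {z} z∈ → let Qz = proj₂ (∈-filter⁻ Q? {xs = xs} z∈) in
        ≡.subst (_∈ map to (filter P? xs)) (proj₂ (Q⇒P Qz))
          (∈-map⁺ to (∈-filter⁺ P? (all _) (proj₁ (Q⇒P Qz)))))
      image)
    (≈-trans (∑-map to (filter P? xs)) (∑-filter P? xs)))
    where
    map! : Unique (map to (filter P? xs))
    map! = Unique.map⁻ {f = from} (≡.subst Unique
      (≡.sym (≡.trans (≡.sym (List.map-∘ (filter P? xs)))
        (List.map-id-local (All.map (proj₂ ∘ P⇒Q) (All.all-filter P? xs)))))
      (Unique.filter⁺ P? xs!))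

    image : ∀ {z} → z ∈ map to (filter P? xs) → z ∈ filter Q? xs
    image z∈ with ∈-map⁻ to z∈
    ... | x , x∈ , refl =
      ∈-filter⁺ Q? (all _) (proj₁ (P⇒Q (proj₂ (∈-filter⁻ P? {xs = xs} x∈))))

-- Counting by filters, and well-foundedness of finite strict orders

module _ {a p q r} {A : Set a} {P : Pred A p} {Q : Pred A q} {R : Pred A r}
         (P? : Decidable P) (Q? : Decidable Q) (R? : Decidable R) where

  length-filter-⊎ : (∀ {x} → P x → Q x ⊎ R x) → (∀ {x} → Q x → P x) → (∀ {x} → R x → P x) →
                    (∀ {x} → Q x → ¬ R x) → ∀ xs →
                    length (filter P? xs) ≡ length (filter Q? xs) ℕ.+ length (filter R? xs)
  length-filter-⊎ split Q⇒P R⇒P disjoint []       = refl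
  length-filter-⊎ split Q⇒P R⇒P disjoint (x ∷ xs) with P? x | Q? x | R? x
  ... | yes _ | yes q | yes r = contradiction r (disjoint q)
  ... | yes _ | yes _ | no _  = ≡.cong suc (length-filter-⊎ split Q⇒P R⇒P disjoint xs)
  ... | yes _ | no _  | yes _ =
    ≡.trans (≡.cong suc (length-filter-⊎ split Q⇒P R⇒P disjoint xs)) (≡.sym (ℕ.+-suc _ _))
  ... | yes p | no ¬q | no ¬r = contradiction (split p) λ { (inj₁ q) → ¬q q ; (inj₂ r) → ¬r r }
  ... | no ¬p | yes q | _     = contradiction (Q⇒P q) ¬p
  ... | no ¬p | no _  | yes r = contradiction (R⇒P r) ¬p
  ... | no _  | no _  | no _  = length-filter-⊎ split Q⇒P R⇒P disjoint xs

length-filter-unique : ∀ {a p} {A : Set a} {P : Pred A p} (P? : Decidable P) {xs : List A} →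
  Unique xs → ∀ {y} → y ∈ xs → P y → (∀ {x} → P x → x ≡ y) → length (filter P? xs) ≡ 1
length-filter-unique P? (x∉ ∷ xs!) (here refl) Py P⇒≡ = ≡.cong length
  (≡.trans (List.filter-accept P? Py)
    (≡.cong (_ ∷_) (List.filter-none P? (All.map (λ y≢x → y≢x ∘ ≡.sym ∘ P⇒≡) x∉))))
length-filter-unique P? (x∉ ∷ xs!) (there y∈) Py P⇒≡ = ≡.trans
  (≡.cong length (List.filter-reject P? (All.lookup x∉ y∈ ∘ P⇒≡)))
  (length-filter-unique P? xs! y∈ Py P⇒≡)


module _ {a r} {A : Set a} {R : Rel A r} (R-trans : Transitive R) (R-irrefl : ∀ {x} → ¬ R x x)
         (R? : Decidable₂ R) {xs : List A} (all : ∀ x → x ∈ xs) where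

  private
    below : A → ℕ
    below y = length (filter (λ x → R? x y) xs)

    below-mono : ∀ {y z} → R y z → below y ℕ.< below z
    below-mono {y} {z} Ryz = ≡.subst (below y ℕ.<_)
      (≡.sym (length-filter-⊎ (λ x → R? x z) (λ x → R? x y) rest? split
        (λ Rxy → R-trans Rxy Ryz) proj₁ (flip proj₂) xs))
      (ℕ.m<m+n (below y) (List.filter-some rest? (Any.map (λ { refl → Ryz , R-irrefl }) (all y))))
      where
      rest? : Decidable (λ x → R x z × ¬ R x y)
      rest? x = R? x z ×-dec ¬? (R? x y)

      split : ∀ {x} → R x z → R x y ⊎ (R x z × ¬ R x y)
      split {x} Rxz with R? x y
      ... | yes Rxy = inj₁ Rxy
      ... | no ¬Rxy = inj₂ (Rxz , ¬Rxy)

  -- The number of list entries below an element is a strictly monotone measure: if `y` is below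
  -- `z`, everything below `y` is still counted for `z`, and `y` itself is added.
  finite-wellFounded : WellFounded R
  finite-wellFounded = Subrelation.wellFounded below-mono (On.wellFounded below ℕ.<-wellFounded)

-- Blocks of non-crossing partitions

private
  variable
    n : ℕ
    π ρ σ τ : NC n
    V W : Subset n

∀ₛ? : ∀ {p} {P : Subset n → Set p} → (∀ V → Dec (P V)) → Dec (∀ V → P V)
∀ₛ? {n} P? = map′ (λ all V → All.lookup all (∈-allSubsets V)) (λ h → All.universal h (allSubsets n))
  (All.all? P? (allSubsets n))

≤-refl : (π : NC n) → π ≤ π
≤-refl π = ∼⇒≤ π π λ _ _ → id

class-⊆ : (π σ : NC n) → π ≤ σ → ∀ i → class π i ⊆ₛ class σ i
class-⊆ π σ π≤σ i = ≤⇒∼ π σ π≤σ i _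

class-≡ : (π : NC n) {i j : Fin n} → NC._∼_ π i j → class π i ≡ class π j
class-≡ π i∼j = Subset.⊆-antisym (∼-trans (∼-sym i∼j)) (∼-trans i∼j)
  where open NCProperties π

block-≡ : (π : NC n) {i : Fin n} → IsBlock π V → i ∈ₛ V → V ≡ class π i
block-≡ π (_ , refl) i∈V = class-≡ π i∈V

class-⊆-block : (π σ : NC n) → π ≤ σ → IsBlock σ V → ∀ {i} → i ∈ₛ V → class π i ⊆ₛ V
class-⊆-block π σ π≤σ V∈σ i∈V = ≡.subst (class π _ ⊆ₛ_) (≡.sym (block-≡ σ V∈σ i∈V)) (class-⊆ π σ π≤σ _)

-- The class of a fixed point can only grow from `π` through `ρ` to `σ`, and here it is the same at
-- both ends.
block-between : (π ρ σ : NC n) → π ≤ ρ → ρ ≤ σ → IsBlock π V → IsBlock σ V → IsBlock ρ V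
block-between π ρ σ π≤ρ ρ≤σ (i , refl) V∈σ =
  i , Subset.⊆-antisym (class-⊆ π ρ π≤ρ i) (class-⊆-block ρ σ ρ≤σ V∈σ (NCProperties.∼-refl π))

class-injective : (π σ : NC n) → (∀ i → class π i ≡ class σ i) → π ≡ σ
class-injective π σ π≡σ = NC-≡ (≡.trans (≡.sym (Vec.tabulate∘lookup (classes π)))
  (≡.trans (Vec.tabulate-cong π≡σ) (Vec.tabulate∘lookup (classes σ))))

blocks⊆⇒≡ : (ρ σ : NC n) → ρ ≤ σ → (∀ V → IsBlock σ V → IsBlock ρ V) → ρ ≡ σ
blocks⊆⇒≡ ρ σ ρ≤σ σ⊆ρ = ≤-antisym ρ≤σ (∼⇒≤ σ ρ λ i j →
  ≡.subst (j ∈ₛ_) (block-≡ ρ (σ⊆ρ _ (i , refl)) (NCProperties.∼-refl σ)))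

𝟙-∼ : (i j : Fin n) → NC._∼_ (𝟙 n) i j
𝟙-∼ i j = ≡.subst (j ∈ₛ_) (≡.sym (Vec.lookup-replicate i _)) Subset.∈⊤

≤𝟙 : (π : NC n) → π ≤ 𝟙 n
≤𝟙 {n} π = ∼⇒≤ π (𝟙 n) λ i j _ → 𝟙-∼ i j

element-∈ : (V : Subset n) (i : Fin ∣ V ∣) → element V i ∈ₛ V
element-∈ (inside  ∷ V) zero    = Vec.here
element-∈ (inside  ∷ V) (suc i) = Vec.there (element-∈ V i)
element-∈ (outside ∷ V) i       = Vec.there (element-∈ V i)

restrict-cong : (π ρ : NC n) (V : Subset n) → π ≤ ρ →
                (∀ {i j} → i ∈ₛ V → NC._∼_ ρ i j → NC._∼_ π i j) → restrict ρ V ≡ restrict π V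
restrict-cong π ρ V π≤ρ ρ⊆π = ≤-antisym
  (∼⇒≤ (restrict ρ V) (restrict π V) λ i j →
    from (restrict-∼ π V i j) ∘ ρ⊆π (element-∈ V i) ∘ to (restrict-∼ ρ V i j))
  (∼⇒≤ (restrict π V) (restrict ρ V) λ i j →
    from (restrict-∼ ρ V i j) ∘ ≤⇒∼ π ρ π≤ρ _ _ ∘ to (restrict-∼ π V i j))
  where open Equivalence

restrict-block : (π : NC n) (V : Subset n) → IsBlock π V → restrict π V ≡ 𝟙 ∣ V ∣
restrict-block π V V∈π = ≤-antisym (≤𝟙 (restrict π V)) (∼⇒≤ (𝟙 ∣ V ∣) (restrict π V) λ i j _ →
  Equivalence.from (restrict-∼ π V i j)
    (≡.subst (element V j ∈ₛ_) (block-≡ π V∈π (element-∈ V i)) (element-∈ V j)))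

-- Gluing two partitions along a block

-- The partition that agrees with α on V and with β off V, when V is a
-- block of a common upper bound of α and β; otherwise β.
module _ (V : Subset n) (α β : NC n) where

  glueClasses : Vec (Subset n) n
  glueClasses = tabulate λ i → if does (i Subset.∈? V) then class α i else class β i

  glue : NC n
  glue with isNonCrossingPartition? glueClasses
  ... | yes p = mkNC glueClasses p
  ... | no _  = β

  module Glue (σ : NC n) (V∈σ : IsBlock σ V) (α≤σ : α ≤ σ) (β≤σ : β ≤ σ) where

    private
      module α = NCProperties α
      module β = NCProperties β
      module σ = NCProperties σ

      _≈_ : Fin n → Fin n → Set
      i ≈ j = j ∈ₛ lookup glueClasses i

      classes-on : ∀ {i} → i ∈ₛ V → lookup glueClasses i ≡ class α i
      classes-on {i} i∈V = ≡.trans (Vec.lookup∘tabulate _ i)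
        (≡.cong (λ b → if b then class α i else class β i) (dec-true (i Subset.∈? V) i∈V))

      classes-off : ∀ {i} → i ∉ₛ V → lookup glueClasses i ≡ class β i
      classes-off {i} i∉V = ≡.trans (Vec.lookup∘tabulate _ i)
        (≡.cong (λ b → if b then class α i else class β i) (dec-false (i Subset.∈? V) i∉V))

      data Related (i j : Fin n) : Set where
        on  : i ∈ₛ V → j ∈ₛ V → NC._∼_ α i j → Related i j
        off : i ∉ₛ V → j ∉ₛ V → NC._∼_ β i j → Related i j

      to : ∀ {i j} → i ≈ j → Related i j
      to {i} {j} i≈j = h (i Subset.∈? V)
        where
        h : Dec (i ∈ₛ V) → Related i j
        h (yes i∈V) = on i∈V (class-⊆-block α σ α≤σ V∈σ i∈V i∼j) i∼j
          where i∼j = ≡.subst (j ∈ₛ_) (classes-on i∈V) i≈j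
        h (no i∉V)  = off i∉V (λ j∈V → i∉V (class-⊆-block β σ β≤σ V∈σ j∈V (β.∼-sym i∼j))) i∼j
          where i∼j = ≡.subst (j ∈ₛ_) (classes-off i∉V) i≈j

      from : ∀ {i j} → Related i j → i ≈ j
      from (on i∈V _ i∼j)  = ≡.subst (_ ∈ₛ_) (≡.sym (classes-on i∈V)) i∼j
      from (off i∉V _ i∼j) = ≡.subst (_ ∈ₛ_) (≡.sym (classes-off i∉V)) i∼j

      related-refl : ∀ {i} → Related i i
      related-refl {i} with i Subset.∈? V
      ... | yes i∈V = on i∈V i∈V α.∼-refl
      ... | no i∉V  = off i∉V i∉V β.∼-refl

      related-sym : ∀ {i j} → Related i j → Related j i
      related-sym (on i∈V j∈V i∼j)  = on j∈V i∈V (α.∼-sym i∼j)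
      related-sym (off i∉V j∉V i∼j) = off j∉V i∉V (β.∼-sym i∼j)

      related-trans : ∀ {i j k} → Related i j → Related j k → Related i k
      related-trans (on i∈V _ i∼j)  (on _ k∈V j∼k)  = on i∈V k∈V (α.∼-trans i∼j j∼k)
      related-trans (off i∉V _ i∼j) (off _ k∉V j∼k) = off i∉V k∉V (β.∼-trans i∼j j∼k)
      related-trans (on _ j∈V _)    (off j∉V _ _)   = contradiction j∈V j∉V
      related-trans (off _ j∉V _)   (on j∈V _ _)    = contradiction j∈V j∉V

      related⇒∼σ : ∀ {i j} → Related i j → NC._∼_ σ i j
      related⇒∼σ (on _ _ i∼j)  = ≤⇒∼ α σ α≤σ _ _ i∼j
      related⇒∼σ (off _ _ i∼j) = ≤⇒∼ β σ β≤σ _ _ i∼j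

      ∈V-resp : ∀ {i j} → NC._∼_ σ i j → i ∈ₛ V → j ∈ₛ V
      ∈V-resp i∼j i∈V = class-⊆-block σ σ (≤-refl σ) V∈σ i∈V i∼j

      related-noncrossing : ∀ {i j k l} → i Fin.< j → j Fin.< k → k Fin.< l →
                            Related i k → Related j l → Related i j
      related-noncrossing i<j j<k k<l r@(on i∈V _ i∼k)  (on j∈V _ j∼l)  =
        on i∈V j∈V (α.noncrossing i<j j<k k<l i∼k j∼l)
      related-noncrossing i<j j<k k<l r@(off i∉V _ i∼k) (off j∉V _ j∼l) =
        off i∉V j∉V (β.noncrossing i<j j<k k<l i∼k j∼l)
      -- A crossing between a class inside `V` and a class outside would link them in `σ`, where `V`
      -- is a whole block.
      related-noncrossing i<j j<k k<l r@(on i∈V _ _)    s@(off j∉V _ _) =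
        contradiction (∈V-resp (σ.noncrossing i<j j<k k<l (related⇒∼σ r) (related⇒∼σ s)) i∈V) j∉V
      related-noncrossing i<j j<k k<l r@(off i∉V _ _)   s@(on j∈V _ _)  =
        contradiction (∈V-resp (σ.∼-sym (σ.noncrossing i<j j<k k<l (related⇒∼σ r) (related⇒∼σ s))) j∈V) i∉V

      isNC : IsNonCrossingPartition glueClasses
      isNC = record
        { isEquivalence = record
            { refl  = from related-refl
            ; sym   = from ∘ related-sym ∘ to
            ; trans = λ r s → from (related-trans (to r) (to s))
            }
        ; noncrossing = λ i<j j<k k<l r s → from (related-noncrossing i<j j<k k<l (to r) (to s))
        }

      classes-glue : classes glue ≡ glueClasses
      classes-glue with isNonCrossingPartition? glueClasses
      ... | yes _   = refl
      ... | no ¬isNC = contradiction isNC ¬isNC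

    class-on : ∀ {i} → i ∈ₛ V → class glue i ≡ class α i
    class-on {i} i∈V = ≡.trans (≡.cong (λ B → lookup B i) classes-glue) (classes-on i∈V)

    class-off : ∀ {i} → i ∉ₛ V → class glue i ≡ class β i
    class-off {i} i∉V = ≡.trans (≡.cong (λ B → lookup B i) classes-glue) (classes-off i∉V)

    ≤-glue : (γ : NC n) → γ ≤ α → γ ≤ β → γ ≤ glue
    ≤-glue γ γ≤α γ≤β = ∼⇒≤ γ glue λ i j → h (i Subset.∈? V)
      where
      h : ∀ {i j} → Dec (i ∈ₛ V) → NC._∼_ γ i j → NC._∼_ glue i j
      h (yes i∈V) = ≡.subst (_ ∈ₛ_) (≡.sym (class-on i∈V)) ∘ ≤⇒∼ γ α γ≤α _ _
      h (no i∉V)  = ≡.subst (_ ∈ₛ_) (≡.sym (class-off i∉V)) ∘ ≤⇒∼ γ β γ≤β _ _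

    glue-≤ : (γ : NC n) → α ≤ γ → β ≤ γ → glue ≤ γ
    glue-≤ γ α≤γ β≤γ = ∼⇒≤ glue γ λ i j → h (i Subset.∈? V)
      where
      h : ∀ {i j} → Dec (i ∈ₛ V) → NC._∼_ glue i j → NC._∼_ γ i j
      h (yes i∈V) = ≤⇒∼ α γ α≤γ _ _ ∘ ≡.subst (_ ∈ₛ_) (class-on i∈V)
      h (no i∉V)  = ≤⇒∼ β γ β≤γ _ _ ∘ ≡.subst (_ ∈ₛ_) (class-off i∉V)

    block⁻ : IsBlock glue W → (W ⊆ₛ V × IsBlock α W) ⊎ (IsBlock β W × ∃[ i ] i ∈ₛ W × i ∉ₛ V)
    block⁻ {W} (i , W≡) = h (i Subset.∈? V)
      where
      h : Dec (i ∈ₛ V) → (W ⊆ₛ V × IsBlock α W) ⊎ (IsBlock β W × ∃[ i ] i ∈ₛ W × i ∉ₛ V)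
      h (yes i∈V) = inj₁
        ( class-⊆-block α σ α≤σ V∈σ i∈V ∘ ≡.subst (_ ∈ₛ_) (≡.trans W≡ (class-on i∈V))
        , i , ≡.trans W≡ (class-on i∈V))
      h (no i∉V)  = inj₂
        ( (i , ≡.trans W≡ (class-off i∉V))
        , i , ≡.subst (i ∈ₛ_) (≡.sym W≡) (NCProperties.∼-refl glue) , i∉V)

    block-on⁺ : IsBlock α W → W ⊆ₛ V → IsBlock glue W
    block-on⁺ (i , refl) W⊆V = i , ≡.sym (class-on (W⊆V α.∼-refl))

    block-off⁺ : IsBlock β W → ∀ {i} → i ∈ₛ W → i ∉ₛ V → IsBlock glue W
    block-off⁺ W∈β {i} i∈W i∉V = i , ≡.trans (block-≡ β W∈β i∈W) (≡.sym (class-off i∉V))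

-- The outer gluing overwrites on `V` whatever the inner one put there, and off `V` both keep `γ`.
-- With `π` and `σ` as `α` and `β`, in either order, this shows that splitting and merging `V` undo
-- each other.
glue-glue : (V : Subset n) (α β γ σ : NC n) → IsBlock σ V → α ≤ σ → β ≤ σ → γ ≤ σ →
            (∀ {i} → i ∈ₛ V → class α i ≡ class γ i) → glue V α (glue V β γ) ≡ γ
glue-glue V α β γ σ V∈σ α≤σ β≤σ γ≤σ α≡γ =
  class-injective (glue V α (glue V β γ)) γ λ i → h (i Subset.∈? V)
  where
  module I = Glue V β γ σ V∈σ β≤σ γ≤σ
  module O = Glue V α (glue V β γ) σ V∈σ α≤σ (I.glue-≤ σ β≤σ γ≤σ)

  h : ∀ {i} → Dec (i ∈ₛ V) → class (glue V α (glue V β γ)) i ≡ class γ i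
  h (yes i∈V) = ≡.trans (O.class-on i∈V) (α≡γ i∈V)
  h (no i∉V)  = ≡.trans (O.class-off i∉V) (I.class-off i∉V)

-- For a chain starting at `π`, this is the exponent that a last term `σ` adds to the sign.
∣_∖_∣ : NC n → NC n → ℕ
∣_∖_∣ {n} σ π = length (filter (λ V → isBlock? σ V ×-dec ¬? (isBlock? π V)) (allSubsets n))

∣σ∖σ∣≡0 : (σ : NC n) → ∣ σ ∖ σ ∣ ≡ 0
∣σ∖σ∣≡0 {n} σ = ≡.cong length (List.filter-none (λ V → isBlock? σ V ×-dec ¬? (isBlock? σ V))
  (All.universal (λ V (V∈σ , V∉σ) → V∉σ V∈σ) (allSubsets n)))

-- Under separation `τ` and `ρ` have the same blocks in common with `σ`, the other inclusion being
-- `block-between`. The sign of the last step can therefore be read off from `ρ` and pulled out of a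
-- sum over `τ`.
∣∖∣-cong : (σ τ ρ : NC n) → τ ≤ ρ → ρ ≤ σ → (∀ V → IsBlock ρ V → IsBlock σ V → IsBlock τ V) →
           ∣ σ ∖ τ ∣ ≡ ∣ σ ∖ ρ ∣
∣∖∣-cong {n} σ τ ρ τ≤ρ ρ≤σ sep = ≡.cong length (List.filter-≐
  (λ V → isBlock? σ V ×-dec ¬? (isBlock? τ V)) (λ V → isBlock? σ V ×-dec ¬? (isBlock? ρ V))
  ( (λ {V} (V∈σ , V∉τ) → V∈σ , λ V∈ρ → V∉τ (sep V V∈ρ V∈σ))
  , (λ {V} (V∈σ , V∉ρ) → V∈σ , λ V∈τ → V∉ρ (block-between τ ρ σ τ≤ρ ρ≤σ V∈τ V∈σ)))
  (allSubsets n))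

-- Partial merges and a sign-reversing involution on them

-- ρ arises from π by merging the blocks of π inside some of the blocks of σ.
record PartialMerge (π σ : NC n) (D : Subset n → Set) (ρ : NC n) : Set where
  constructor partialMerge
  field
    lower    : π ≤ ρ
    upper    : ρ ≤ σ
    contains : ∀ V → D V → IsBlock ρ V
    merged   : ∀ V → IsBlock ρ V → ¬ IsBlock π V → IsBlock σ V

partialMerge? : (π σ : NC n) {D : Subset n → Set} → Decidable D → Decidable (PartialMerge π σ D)
partialMerge? π σ D? ρ = map′ (λ (l , u , c , m) → partialMerge l u c m)
  (λ (partialMerge l u c m) → l , u , c , m)
  ((π ≤? ρ) ×-dec (ρ ≤? σ) ×-dec (∀ₛ? λ V → D? V →-dec isBlock? ρ V)
    ×-dec ∀ₛ? λ V → isBlock? ρ V →-dec (¬? (isBlock? π V) →-dec isBlock? σ V))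

-- A block `V` of `σ` that is neither in `π` nor prescribed by `D` can be merged or left split
-- freely. Switching between the two pairs off the partial merges and changes the number of missing
-- blocks of `σ` by one.
module Toggle (π σ : NC n) (π≤σ : π ≤ σ) {D : Subset n → Set} (D⊆σ : ∀ {V} → D V → IsBlock σ V)
              (V : Subset n) (V∈σ : IsBlock σ V) (V∉π : ¬ IsBlock π V) (V∉D : ¬ D V) where

  private
    σ-block-⊆ : IsBlock σ W → W ⊆ₛ V → W ≡ V
    σ-block-⊆ W∈σ@(i , refl) W⊆V = ≡.sym (block-≡ σ V∈σ (W⊆V (NCProperties.∼-refl σ)))

    outside-V : IsBlock σ W → W ≢ V → ∃[ i ] i ∈ₛ W × i ∉ₛ V
    outside-V (i , refl) W≢V = i , NCProperties.∼-refl σ , λ i∈V → W≢V (≡.sym (block-≡ σ V∈σ i∈V))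

    module _ (ρ : NC n) (merge : PartialMerge π σ D ρ) where
      open PartialMerge merge
      module G⁺ = Glue V σ ρ σ V∈σ (≤-refl σ) upper
      module G⁻ = Glue V π ρ σ V∈σ π≤σ upper

      ρ⁺ = glue V σ ρ
      ρ⁻ = glue V π ρ

      V∈ρ⁺ : IsBlock ρ⁺ V
      V∈ρ⁺ = G⁺.block-on⁺ V∈σ id

      V∉ρ⁻ : ¬ IsBlock ρ⁻ V
      V∉ρ⁻ V∈ρ⁻ with G⁻.block⁻ V∈ρ⁻
      ... | inj₁ (_ , V∈π)            = V∉π V∈π
      ... | inj₂ (_ , _ , i∈V , i∉V) = i∉V i∈V

      keep⁺ : IsBlock ρ W → IsBlock σ W → W ≢ V → IsBlock ρ⁺ W
      keep⁺ W∈ρ W∈σ W≢V = let _ , i∈W , i∉V = outside-V W∈σ W≢V in G⁺.block-off⁺ W∈ρ i∈W i∉V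

      keep⁻ : IsBlock ρ W → IsBlock σ W → W ≢ V → IsBlock ρ⁻ W
      keep⁻ W∈ρ W∈σ W≢V = let _ , i∈W , i∉V = outside-V W∈σ W≢V in G⁻.block-off⁺ W∈ρ i∈W i∉V

      merge⁺ : PartialMerge π σ D ρ⁺
      merge⁺ = partialMerge (G⁺.≤-glue π π≤σ lower) (G⁺.glue-≤ σ (≤-refl σ) upper)
        (λ W W∈D → keep⁺ (contains W W∈D) (D⊆σ W∈D) λ { refl → V∉D W∈D })
        (λ W W∈ρ⁺ W∉π → h (G⁺.block⁻ W∈ρ⁺) W∉π)
        where
        h : ∀ {W} → (W ⊆ₛ V × IsBlock σ W) ⊎ (IsBlock ρ W × ∃[ i ] i ∈ₛ W × i ∉ₛ V) →
            ¬ IsBlock π W → IsBlock σ W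
        h (inj₁ (_ , W∈σ)) _   = W∈σ
        h (inj₂ (W∈ρ , _)) W∉π = merged _ W∈ρ W∉π

      merge⁻ : PartialMerge π σ D ρ⁻
      merge⁻ = partialMerge (G⁻.≤-glue π (≤-refl π) lower) (G⁻.glue-≤ σ π≤σ upper)
        (λ W W∈D → keep⁻ (contains W W∈D) (D⊆σ W∈D) λ { refl → V∉D W∈D })
        (λ W W∈ρ⁻ W∉π → h (G⁻.block⁻ W∈ρ⁻) W∉π)
        where
        h : ∀ {W} → (W ⊆ₛ V × IsBlock π W) ⊎ (IsBlock ρ W × ∃[ i ] i ∈ₛ W × i ∉ₛ V) →
            ¬ IsBlock π W → IsBlock σ W
        h (inj₁ (_ , W∈π)) W∉π = contradiction W∈π W∉π
        h (inj₂ (W∈ρ , _)) W∉π = merged _ W∈ρ W∉π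

      -- A class of `ρ` inside `V` that is not a block of `π` would be a block of `σ`, hence `V`
      -- itself. So if `V` is split, `ρ` agrees with `π` on it.
      undo⁺ : ¬ IsBlock ρ V → glue V π ρ⁺ ≡ ρ
      undo⁺ V∉ρ = glue-glue V π σ ρ σ V∈σ π≤σ (≤-refl σ) upper λ {i} i∈V →
        h i∈V (isBlock? π (class ρ i))
        where
        h : ∀ {i} → i ∈ₛ V → Dec (IsBlock π (class ρ i)) → class π i ≡ class ρ i
        h i∈V (yes ∈π) = ≡.sym (block-≡ π ∈π (NCProperties.∼-refl ρ))
        h {i} i∈V (no ∉π) = contradiction
          (i , ≡.trans (block-≡ σ V∈σ i∈V)
            (≡.sym (block-≡ σ (merged (class ρ i) (i , refl) ∉π) (NCProperties.∼-refl ρ)))) V∉ρ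

      undo⁻ : IsBlock ρ V → glue V σ ρ⁻ ≡ ρ
      undo⁻ V∈ρ = glue-glue V σ π ρ σ V∈σ (≤-refl σ) π≤σ upper λ i∈V →
        ≡.trans (≡.sym (block-≡ σ V∈σ i∈V)) (block-≡ ρ V∈ρ i∈V)

      -- Every other block of `σ` has a point off `V`, where the gluing changes nothing, so only the
      -- status of `V` differs.
      count⁺ : ¬ IsBlock ρ V → ∣ σ ∖ ρ ∣ ≡ suc ∣ σ ∖ ρ⁺ ∣
      count⁺ V∉ρ = ≡.trans
        (length-filter-⊎ (λ W → isBlock? σ W ×-dec ¬? (isBlock? ρ W)) (_≟ₛ V)
          (λ W → isBlock? σ W ×-dec ¬? (isBlock? ρ⁺ W))
          (λ {W} (W∈σ , W∉ρ) → split W∈σ W∉ρ (W ≟ₛ V))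
          (λ { refl → V∈σ , V∉ρ })
          (λ (W∈σ , W∉ρ⁺) → W∈σ , λ W∈ρ → W∉ρ⁺ (keep⁺ W∈ρ W∈σ λ { refl → W∉ρ⁺ V∈ρ⁺ }))
          (λ { refl (_ , V∉ρ⁺) → V∉ρ⁺ V∈ρ⁺ })
          (allSubsets n))
        (≡.cong (ℕ._+ ∣ σ ∖ ρ⁺ ∣)
          (length-filter-unique (_≟ₛ V) (allSubsets-unique n) (∈-allSubsets V) refl id))
        where
        split : IsBlock σ W → ¬ IsBlock ρ W → Dec (W ≡ V) →
                W ≡ V ⊎ (IsBlock σ W × ¬ IsBlock ρ⁺ W)
        split W∈σ W∉ρ (yes W≡V) = inj₁ W≡V
        split W∈σ W∉ρ (no W≢V)  = inj₂ (W∈σ , λ W∈ρ⁺ → h (G⁺.block⁻ W∈ρ⁺))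
          where
          h : ¬ ((_ ⊆ₛ V × IsBlock σ _) ⊎ (IsBlock ρ _ × ∃[ i ] i ∈ₛ _ × i ∉ₛ V))
          h (inj₁ (W⊆V , _)) = W≢V (σ-block-⊆ W∈σ W⊆V)
          h (inj₂ (W∈ρ , _)) = W∉ρ W∈ρ

  Split Merged : NC n → Set
  Split  ρ = ¬ IsBlock ρ V × PartialMerge π σ D ρ
  Merged ρ = IsBlock ρ V × PartialMerge π σ D ρ

  split⇒merged : ∀ {ρ} → Split ρ → Merged (glue V σ ρ) × glue V π (glue V σ ρ) ≡ ρ
  split⇒merged {ρ} (V∉ρ , merge) = (V∈ρ⁺ ρ merge , merge⁺ ρ merge) , undo⁺ ρ merge V∉ρ

  merged⇒split : ∀ {ρ} → Merged ρ → Split (glue V π ρ) × glue V σ (glue V π ρ) ≡ ρ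
  merged⇒split {ρ} (V∈ρ , merge) = (V∉ρ⁻ ρ merge , merge⁻ ρ merge) , undo⁻ ρ merge V∈ρ

  split-count : ∀ {ρ} → Split ρ → ∣ σ ∖ ρ ∣ ≡ suc ∣ σ ∖ glue V σ ρ ∣
  split-count {ρ} (V∉ρ , merge) = count⁺ ρ merge V∉ρ

-- Induction along refinement, and lists viewed from their last entry

<-wellFounded : ∀ n → WellFounded (_<_ {n})
<-wellFounded n = finite-wellFounded
  (λ {π} {ρ} {σ} → <-trans {π = π} {ρ} {σ}) (λ π<π → proj₂ π<π refl) _<?_ ∈-allNC

>-wellFounded : ∀ n → WellFounded (flip (_<_ {n}))
>-wellFounded n = finite-wellFounded
  (λ {π} {ρ} {σ} π>ρ ρ>σ → <-trans {π = σ} {ρ} {π} ρ>σ π>ρ) (λ π<π → proj₂ π<π refl)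
  (λ π σ → σ <? π) ∈-allNC

module _ {a ℓ} {A : Set a} {R : Rel A ℓ} where

  allPairs-lookup : ∀ {xs} → AllPairs R xs →
                    ∀ {i j} → i Fin.< j → R (List.lookup xs i) (List.lookup xs j)
  allPairs-lookup (Rx ∷ _)  {zero}  {suc j} _           = All.lookup Rx (∈-lookup j)
  allPairs-lookup (_ ∷ Rxs) {suc i} {suc j} (ℕ.s≤s i<j) = allPairs-lookup Rxs i<j

  allPairs-∷ʳ⁻ : ∀ xs {y} → AllPairs R (xs ∷ʳ y) → AllPairs R xs × All (λ x → R x y) xs
  allPairs-∷ʳ⁻ []       _          = [] , []
  allPairs-∷ʳ⁻ (x ∷ xs) (Rx ∷ Rxs) =
    let Rxs′ , Rxsy = allPairs-∷ʳ⁻ xs Rxs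
        Rx′ , Rxy   = All.∷ʳ⁻ Rx
    in Rx′ ∷ Rxs′ , Rxy ∷ Rxsy

  linked-∷ʳ⁻ : ∀ x xs {y} → Linked R (x ∷ xs ∷ʳ y) →
               Linked R (x ∷ xs) × ∃[ z ] last (x ∷ xs) ≡ just z × R z y
  linked-∷ʳ⁻ x []        (Rxy ∷ [-]) = [-] , x , refl , Rxy
  linked-∷ʳ⁻ x (x′ ∷ xs) (Rxx′ ∷ Rxs) =
    let Rxs′ , z , last≡ , Rzy = linked-∷ʳ⁻ x′ xs Rxs in Rxx′ ∷ Rxs′ , z , last≡ , Rzy

module _ {a} {A : Set a} where

  last-∷ʳ : ∀ (xs : List A) y → last (xs ∷ʳ y) ≡ just y
  last-∷ʳ []            y = refl
  last-∷ʳ (x ∷ [])      y = refl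
  last-∷ʳ (x ∷ x′ ∷ xs) y = last-∷ʳ (x′ ∷ xs) y

  last-∈ : ∀ (xs : List A) {y} → last xs ≡ just y → y ∈ xs
  last-∈ (x ∷ [])      refl = here refl
  last-∈ (x ∷ x′ ∷ xs) eq   = there (last-∈ (x′ ∷ xs) eq)

-- Efficient chains

-- The pairwise form of efficiency: no block outside the start `π` occurs in two different later
-- terms. As an `AllPairs` condition it passes to initial segments, so chains can be taken apart
-- from the end.
Separated : NC n → NC n → NC n → Set
Separated π ρ σ = ∀ V → IsBlock ρ V → IsBlock σ V → IsBlock π V

efficient⇒separated : ∀ (π : NC n) ρs → Efficient (π ∷ ρs) → AllPairs (Separated π) ρs
efficient⇒separated π ρs eff = ≡.subst (AllPairs (Separated π)) (List.tabulate-lookup ρs)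
  (AllPairs.tabulate⁺-< λ {i} {j} i<j V V∈ρᵢ V∈ρⱼ → h i<j V V∈ρᵢ V∈ρⱼ (isBlock? π V))
  where
  h : ∀ {i j} → i Fin.< j → ∀ V → IsBlock (List.lookup ρs i) V → IsBlock (List.lookup ρs j) V →
      Dec (IsBlock π V) → IsBlock π V
  h i<j V V∈ρᵢ V∈ρⱼ (yes V∈π) = V∈π
  h {i} {j} i<j V V∈ρᵢ V∈ρⱼ (no V∉π) =
    let k , _ , unique = eff V (there (Any.map (λ { refl → V∈ρᵢ }) (∈-lookup {xs = ρs} i)) , V∉π)
    in contradiction i<j (ℕ.<-irrefl (≡.cong Fin.toℕ (≡.trans (≡.sym (unique V∈ρᵢ)) (unique V∈ρⱼ))))

separated⇒efficient : ∀ (π : NC n) ρs → AllPairs (Separated π) ρs → Efficient (π ∷ ρs)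
separated⇒efficient π ρs sep V (here V∈π , V∉π) = contradiction V∈π V∉π
separated⇒efficient π ρs sep V (there V∈ , V∉π) = Any.index V∈ , Any.lookup-index V∈ , unique
  where
  unique : ∀ {j} → IsBlock (List.lookup ρs j) V → Any.index V∈ ≡ j
  unique {j} V∈ρⱼ with Fin.<-cmp (Any.index V∈) j
  ... | tri< i<j _ _ = contradiction (allPairs-lookup sep i<j V (Any.lookup-index V∈) V∈ρⱼ) V∉π
  ... | tri≈ _ i≡j _ = i≡j
  ... | tri> _ _ j<i = contradiction (allPairs-lookup sep j<i V V∈ρⱼ (Any.lookup-index V∈)) V∉π

extend : NC n → Tuple n → Tuple n
extend σ c = List⁺.head c ∷ (List⁺.tail c ∷ʳ σ)

extend-injective : {c d : Tuple n} → extend σ c ≡ extend σ d → c ≡ d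
extend-injective {c = π ∷ ρs} {d = π′ ∷ ρs′} eq =
  ≡.cong₂ _∷_ (≡.cong List⁺.head eq) (List.∷ʳ-injectiveˡ ρs ρs′ (≡.cong List⁺.tail eq))

chain-≤ : ∀ (π : NC n) ρs → Linked _<_ (π ∷ ρs) → last (π ∷ ρs) ≡ just σ → All (_≤ σ) (π ∷ ρs)
chain-≤ π []       _                   refl = ≤-refl π ∷ []
chain-≤ {σ = σ} π (ρ ∷ ρs) ((π≤ρ , _) ∷ asc) last≡ with chain-≤ ρ ρs asc last≡
... | ρ≤σ ∷ ρs≤σ = ≤-trans {π = π} {ρ} {σ} π≤ρ ρ≤σ ∷ ρ≤σ ∷ ρs≤σ

-- `lower` is not strict, since `ρ` may be `π` itself: this is how the chain with the single step
-- from `π` to `σ` arises.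
record IsStep (π ρ σ : NC n) : Set where
  constructor step
  field
    lower     : π ≤ ρ
    upper     : ρ < σ
    separated : Separated π ρ σ

isStep? : (π ρ σ : NC n) → Dec (IsStep π ρ σ)
isStep? π ρ σ = map′ (λ (l , u , s) → step l u s) (λ (step l u s) → l , u , s)
  ((π ≤? ρ) ×-dec (ρ <? σ) ×-dec ∀ₛ? λ V → isBlock? ρ V →-dec (isBlock? σ V →-dec isBlock? π V))

-- The terms of a chain having V as a block form an interval, so separating
-- σ from the last term ρ separates it from all of them.
efficient-extend⁺ : {c : Tuple n} → IsStep π ρ σ → IsEfficientChain π ρ c →
                    IsEfficientChain π σ (extend σ c)
efficient-extend⁺ {π = π} {ρ} {σ} {c = .π ∷ ρs}
                  (step π≤ρ (ρ≤σ , ρ≢σ) sep) (mkChain refl ends asc , eff) =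
  mkChain refl (last-∷ʳ (π ∷ ρs) σ) (Linked.++⁺ asc connected [-]) ,
  separated⇒efficient π (ρs ∷ʳ σ) (AllPairs.++⁺ (efficient⇒separated π ρs eff) ([] ∷ [])
    (All.map (λ {τ} τ≤ρ → (λ V V∈τ V∈σ → sep V (block-between τ ρ σ τ≤ρ ρ≤σ V∈τ V∈σ) V∈σ) ∷ [])
      (All.tail (chain-≤ π ρs asc ends))))
  where
  connected : Connected _<_ (last (π ∷ ρs)) (just σ)
  connected = ≡.subst (λ m → Connected _<_ m (just σ)) (≡.sym ends) (just (ρ≤σ , ρ≢σ))

efficient-extend⁻ : π ≢ σ → ∀ {c} → IsEfficientChain π σ c →
                    ∃[ ρ ] IsStep π ρ σ × ∃[ d ] IsEfficientChain π ρ d × c ≡ extend σ d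
efficient-extend⁻ {π = π} {σ} π≢σ {.π ∷ ρs} (mkChain refl ends asc , eff) with initLast ρs
... | []         = contradiction (Maybe.just-injective ends) π≢σ
... | ρs′ ∷ʳ′ σ′ with Maybe.just-injective (≡.trans (≡.sym (last-∷ʳ (π ∷ ρs′) σ′)) ends)
...   | refl =
  let asc′ , ρ , last≡ , ρ<σ = linked-∷ʳ⁻ π ρs′ asc
      sep , sepσ = allPairs-∷ʳ⁻ ρs′ (efficient⇒separated π (ρs′ ∷ʳ σ) eff)
  in ρ , step (All.head (chain-≤ π ρs′ asc′ last≡)) ρ<σ
           -- The last remaining term is `π` when `ρs′` is empty, so the trivial separation of `π`
           -- is put in front of `sepσ`.
           (All.lookup {P = λ τ → Separated π τ σ} ((λ V V∈π _ → V∈π) ∷ sepσ) (last-∈ (π ∷ ρs′) last≡)) ,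
     (π ∷ ρs′) , (mkChain refl last≡ asc′ , separated⇒efficient π ρs′ sep) , refl

efficient-refl : (π : NC n) → ∀ {c} → IsEfficientChain π π c → c ≡ π ∷ []
efficient-refl π {.π ∷ []} (mkChain refl _ _ , _) = refl
efficient-refl π {.π ∷ ρ ∷ ρs} (mkChain refl ends ((π≤ρ , π≢ρ) ∷ asc) , _) =
  contradiction (≤-antisym π≤ρ (All.head (chain-≤ ρ ρs asc ends))) π≢ρ

efficient-singleton : (π : NC n) → IsEfficientChain π π (π ∷ [])
efficient-singleton π = mkChain refl refl [-] , separated⇒efficient π [] []

-- By separation, a block of `σ` that already occurs in the chain is a block of `π`. Hence nothing
-- is counted twice.
length-Blocks⁺-extend : ∀ {c} → IsStep π ρ σ → IsEfficientChain π ρ c →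
                        length (Blocks⁺ (extend σ c)) ≡ length (Blocks⁺ c) ℕ.+ ∣ σ ∖ π ∣
length-Blocks⁺-extend {n} {π} {ρ} {σ} {.π ∷ ρs}
                      (step π≤ρ (ρ≤σ , _) sep) (mkChain refl ends asc , _) =
  length-filter-⊎ (inBlocks⁺? (extend σ (π ∷ ρs))) (inBlocks⁺? (π ∷ ρs))
    (λ V → isBlock? σ V ×-dec ¬? (isBlock? π V)) split
    (λ (V∈ , V∉π) → Any.++⁺ˡ V∈ , V∉π) (λ (V∈σ , V∉π) → Any.++⁺ʳ (π ∷ ρs) (here V∈σ) , V∉π)
    (λ {V} (V∈ , V∉π) (V∈σ , _) → disjoint V∈ V∈σ V∉π)
    (allSubsets n)
  where
  split : InBlocks⁺ (extend σ (π ∷ ρs)) V → InBlocks⁺ (π ∷ ρs) V ⊎ (IsBlock σ V × ¬ IsBlock π V)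
  split (V∈ , V∉π) with Any.++⁻ (π ∷ ρs) V∈
  ... | inj₁ V∈c        = inj₁ (V∈c , V∉π)
  ... | inj₂ (here V∈σ) = inj₂ (V∈σ , V∉π)

  disjoint : InBlocks (π ∷ ρs) V → IsBlock σ V → ¬ ¬ IsBlock π V
  disjoint V∈ V∈σ V∉π =
    let τ≤ρ , V∈τ = All.lookupAny (chain-≤ π ρs asc ends) V∈
    in V∉π (sep _ (block-between (List.lookup (π ∷ ρs) (Any.index V∈)) ρ σ τ≤ρ ρ≤σ V∈τ V∈σ) V∈σ)

extensions : (π σ : NC n) → List (Tuple n)
extensions {n} π σ =
  concatMap (λ ρ → map (extend σ) (EC π ρ)) (filter (λ ρ → isStep? π ρ σ) (allNC n))

-- The last entry of the shortened chain recovers `ρ`, so the lists for different `ρ` are disjoint.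
extensions-unique : (π σ : NC n) → Unique (extensions π σ)
extensions-unique {n} π σ = Unique.concat⁺
  (All.map⁺ (All.universal (λ ρ → Unique.map⁺ extend-injective (EC-unique π ρ)) _))
  (AllPairs.map⁺ (AllPairs.map disjoint (Unique.filter⁺ (λ ρ → isStep? π ρ σ) (allNC-unique n))))
  where
  ends : ∀ ρ {c} → c ∈ EC π ρ → last (toList c) ≡ just ρ
  ends ρ c∈ = IsChain.ends (proj₁ (Equivalence.to (∈-EC {π = π} {ρ}) c∈))

  disjoint : ∀ {ρ ρ′} → ρ ≢ ρ′ → Disjoint (map (extend σ) (EC π ρ)) (map (extend σ) (EC π ρ′))
  disjoint {ρ} {ρ′} ρ≢ρ′ (c∈ , c∈′) =
    let d  , d∈  , c≡  = ∈-map⁻ (extend σ) {xs = EC π ρ} c∈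
        d′ , d∈′ , c≡′ = ∈-map⁻ (extend σ) {xs = EC π ρ′} c∈′
        d≡d′ = extend-injective {c = d} {d′} (≡.trans (≡.sym c≡) c≡′)
    in ρ≢ρ′ (Maybe.just-injective
      (≡.trans (≡.sym (ends ρ d∈)) (≡.trans (≡.cong (last ∘ toList) d≡d′) (ends ρ′ d∈′))))

∈-extensions⁺ : π ≢ σ → ∀ {c} → c ∈ EC π σ → c ∈ extensions π σ
∈-extensions⁺ {π = π} {σ} π≢σ c∈ =
  let ρ , st , d , d-eff , c≡ = efficient-extend⁻ π≢σ (Equivalence.to (∈-EC {π = π} {σ}) c∈)
  in ≡.subst (_∈ extensions π σ) (≡.sym c≡)
    (∈-concat⁺′ (∈-map⁺ (extend σ) (Equivalence.from (∈-EC {π = π} {ρ}) d-eff))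
      (∈-map⁺ (λ ρ → map (extend σ) (EC π ρ)) (∈-filter⁺ (λ ρ → isStep? π ρ σ) (∈-allNC ρ) st)))

∈-extensions⁻ : ∀ (π σ : NC n) {c} → c ∈ extensions π σ → c ∈ EC π σ
∈-extensions⁻ {n} π σ {c} c∈ =
  let cs , c∈cs , cs∈ = ∈-concat⁻′ (map (λ ρ → map (extend σ) (EC π ρ)) ρs) c∈
      ρ , ρ∈ , cs≡   = ∈-map⁻ (λ ρ → map (extend σ) (EC π ρ)) {xs = ρs} cs∈
      d , d∈ , c≡    = ∈-map⁻ (extend σ) {xs = EC π ρ} (≡.subst (c ∈_) cs≡ c∈cs)
  in ≡.subst (_∈ EC π σ) (≡.sym c≡) (Equivalence.from (∈-EC {π = π} {σ})
    (efficient-extend⁺ (proj₂ (∈-filter⁻ (λ ρ → isStep? π ρ σ) {xs = allNC n} ρ∈))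
      (Equivalence.to (∈-EC {π = π} {ρ}) d∈)))
  where ρs = filter (λ ρ → isStep? π ρ σ) (allNC n)

-- The antipode

module Antipode {c ℓ} (K : CommutativeRing c ℓ) where

  open HopfAlgebra K

  private
    T : CommutativeRing _ _
    T = Polynomials.commutativeRing K Index

    module T = CommutativeRing T
    module TP = RingProperties T.ring

  open BigOperator T.+-commutativeMonoid
  private
    module ∏ = BigOperator T.*-commutativeMonoid
  open ∏ using () renaming (∑ to ∏)
  open SemiringExp T.semiring using (^-homo-*)
  open ≈-Reasoning T.setoid

  *-∑ : ∀ {a} {A : Set a} x (xs : List A) {f : A → 𝒯} → x * ∑ xs f ≈ ∑ xs (λ y → x * f y)
  *-∑ x []       = T.zeroʳ x
  *-∑ x (y ∷ xs) = T.trans (T.distribˡ x _ _) (T.+-congˡ (*-∑ x xs))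

  ∑-* : ∀ {a} {A : Set a} (xs : List A) {f : A → 𝒯} x → ∑ xs f * x ≈ ∑ xs (λ y → f y * x)
  ∑-* xs x = T.trans (T.*-comm _ x) (T.trans (*-∑ x xs) (∑-cong xs λ _ → T.*-comm x _))

  *-when : ∀ {p} {P : Set p} (P? : Dec P) x {y} → x * when P? y ≈ when P? (x * y)
  *-when (yes _) x = T.refl
  *-when (no _)  x = T.zeroʳ x

  when-* : ∀ {p} {P : Set p} (P? : Dec P) {x} y → when P? x * y ≈ when P? (x * y)
  when-* (yes _) y = T.refl
  when-* (no _)  y = T.zeroˡ y

  *-rearrange : ∀ w x y z → w * (x * (y * z)) ≈ (y * z) * (w * x)
  *-rearrange w x y z = T.trans (T.sym (T.*-assoc w x (y * z))) (T.*-comm (w * x) (y * z))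

  X-𝟙 : ∀ n → X (𝟙 n) ≡ 1#
  X-𝟙 n with 𝟙 n ≟ 𝟙 n
  ... | yes _  = refl
  ... | no 𝟙≢𝟙 = contradiction refl 𝟙≢𝟙

  X-restrict-block : (π : NC n) → IsBlock π V → X (restrict π V) ≈ 1#
  X-restrict-block {V = V} π V∈π =
    T.reflexive (≡.trans (≡.cong X (restrict-block π V V∈π)) (X-𝟙 ∣ V ∣))

  -- Taking the product over all subsets, with factor `1#` at non-blocks, lets products over the
  -- blocks of different partitions be multiplied factor by factor.
  M-∏ : (π σ : NC n) → M π σ ≈ ∏ (allSubsets n) (λ V → ∏.when (isBlock? σ V) (X (restrict π V)))
  M-∏ {n} π σ = ∏.∑-filter (isBlock? σ) (allSubsets n)

  M-refl : (π : NC n) → M π π ≈ 1#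
  M-refl {n} π = T.trans (M-∏ π π) (T.trans
    (∏.∑-cong (allSubsets n) {g = λ _ → 1#} λ V → h (isBlock? π V))
    (∏.∑-ε (allSubsets n)))
    where
    h : (V∈? : Dec (IsBlock π V)) → ∏.when V∈? (X (restrict π V)) ≈ 1#
    h (yes V∈π) = X-restrict-block π V∈π
    h (no _)    = T.refl

  -- Each block `V` of `σ` gets its factor from exactly one side. If `V` is a block of `ρ`, the
  -- second factor is `1#`; otherwise `ρ` and `π` agree on `V`. A block of `ρ` that is not one of
  -- `σ` must be a block of `π` and contributes `1#`.
  M-merge : (π ρ σ : NC n) → π ≤ ρ → ρ ≤ σ → (∀ V → IsBlock ρ V → ¬ IsBlock π V → IsBlock σ V) →
            M π ρ * M ρ σ ≈ M π σ
  M-merge {n} π ρ σ π≤ρ ρ≤σ merged = begin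
    M π ρ * M ρ σ
      ≈⟨ T.*-cong (M-∏ π ρ) (M-∏ ρ σ) ⟩
    ∏ (allSubsets n) (λ V → ∏.when (isBlock? ρ V) (X (restrict π V)))
      * ∏ (allSubsets n) (λ V → ∏.when (isBlock? σ V) (X (restrict ρ V)))
      ≈⟨ ∏.∑-∙ (allSubsets n) ⟨
    ∏ (allSubsets n) (λ V → ∏.when (isBlock? ρ V) (X (restrict π V))
                            * ∏.when (isBlock? σ V) (X (restrict ρ V)))
      ≈⟨ ∏.∑-cong (allSubsets n) (λ V → h (isBlock? ρ V) (isBlock? σ V) (isBlock? π V)) ⟩
    ∏ (allSubsets n) (λ V → ∏.when (isBlock? σ V) (X (restrict π V)))
      ≈⟨ M-∏ π σ ⟨
    M π σ ∎
    where
    unmerged : IsBlock σ V → ¬ IsBlock ρ V → ∀ {i j} → i ∈ₛ V → NC._∼_ ρ i j → NC._∼_ π i j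
    unmerged {V} V∈σ V∉ρ {i} {j} i∈V i∼j = k (isBlock? π (class ρ i))
      where
      k : Dec (IsBlock π (class ρ i)) → NC._∼_ π i j
      k (yes ∈π) = ≡.subst (j ∈ₛ_) (block-≡ π ∈π (NCProperties.∼-refl ρ)) i∼j
      k (no ∉π)  = contradiction
        (i , ≡.trans (block-≡ σ V∈σ i∈V)
          (≡.sym (block-≡ σ (merged (class ρ i) (i , refl) ∉π) (NCProperties.∼-refl ρ)))) V∉ρ

    h : (V∈ρ? : Dec (IsBlock ρ V)) (V∈σ? : Dec (IsBlock σ V)) → Dec (IsBlock π V) →
        ∏.when V∈ρ? (X (restrict π V)) * ∏.when V∈σ? (X (restrict ρ V)) ≈ ∏.when V∈σ? (X (restrict π V))
    h (yes V∈ρ) (yes V∈σ) _         = T.trans (T.*-congˡ (X-restrict-block ρ V∈ρ)) (T.*-identityʳ _)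
    h (yes V∈ρ) (no _)    (yes V∈π) = T.trans (T.*-identityʳ _) (X-restrict-block π V∈π)
    h (yes V∈ρ) (no V∉σ)  (no V∉π)  = contradiction (merged _ V∈ρ V∉π) V∉σ
    h {V} (no V∉ρ) (yes V∈σ) _      = T.trans (T.*-identityˡ _)
      (T.reflexive (≡.cong X (restrict-cong π ρ V π≤ρ (unmerged V∈σ V∉ρ))))
    h (no _)    (no _)    _         = T.*-identityˡ _

  productFrom-∷ʳ : ∀ (π : NC n) ρs → last (π ∷ ρs) ≡ just ρ →
                   productFrom π (ρs ∷ʳ σ) ≈ productFrom π ρs * M ρ σ
  productFrom-∷ʳ π []       refl  = T.*-comm _ _
  productFrom-∷ʳ π (ρ ∷ ρs) last≡ =
    T.trans (T.*-congˡ (productFrom-∷ʳ ρ ρs last≡)) (T.sym (T.*-assoc _ _ _))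

  -- Signed sums over efficient chains

  sign : ℕ → 𝒯
  sign k = (- 1#) ^ k

  sign-opposite : ∀ k l → k ≡ suc l → sign l + sign k ≈ 0#
  sign-opposite _ l refl = T.trans (T.+-congˡ (TP.-1*x≈-x (sign l))) (T.-‿inverseʳ (sign l))

  term : Tuple n → 𝒯
  term c = sign (length (Blocks⁺ c)) * Mᶜ c

  term-extend : ∀ {c : Tuple n} → IsStep π ρ σ → IsEfficientChain π ρ c →
                term (extend σ c) ≈ term c * (sign ∣ σ ∖ π ∣ * M ρ σ)
  term-extend {π = π} {ρ} {σ} {c} st eff@(mkChain starts ends _ , _) = begin
    sign (length (Blocks⁺ (extend σ c))) * Mᶜ (extend σ c)
      ≈⟨ T.*-cong
           (T.trans (T.reflexive (≡.cong sign (length-Blocks⁺-extend st eff)))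
             (^-homo-* (- 1#) (length (Blocks⁺ c)) ∣ σ ∖ π ∣))
           (productFrom-∷ʳ (List⁺.head c) (List⁺.tail c) ends) ⟩
    (sign (length (Blocks⁺ c)) * sign ∣ σ ∖ π ∣) * (Mᶜ c * M ρ σ)
      ≈⟨ *-interchange _ _ _ _ ⟩
    term c * (sign ∣ σ ∖ π ∣ * M ρ σ) ∎
    where
    open CommutativeSemigroupProperties T.*-commutativeSemigroup
      using () renaming (interchange to *-interchange)

  efficientSum : NC n → NC n → 𝒯
  efficientSum π σ = ∑ (EC π σ) term

  efficientSum-refl : (π : NC n) → efficientSum π π ≈ 1#
  efficientSum-refl {n} π = begin
    ∑ (EC π π) term
      ≈⟨ ∑-unique {xs = EC π π} {ys = (π ∷ []) ∷ []} (EC-unique π π) ([] ∷ [])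
           (λ c∈ → here (efficient-refl π (Equivalence.to (∈-EC {π = π} {π}) c∈)))
           (λ { (here refl) → Equivalence.from (∈-EC {π = π} {π}) (efficient-singleton π) }) ⟩
    term (π ∷ []) + 0#
      ≈⟨ T.+-identityʳ _ ⟩
    sign (length (Blocks⁺ (π ∷ []))) * 1#
      ≈⟨ T.*-identityʳ _ ⟩
    sign (length (Blocks⁺ (π ∷ [])))
      ≡⟨ ≡.cong (sign ∘ length) (List.filter-none (inBlocks⁺? (π ∷ []))
           (All.universal (λ { V (here V∈π , V∉π) → V∉π V∈π }) (allSubsets n))) ⟩
    1# ∎

  -- Cutting off the last term is a bijection onto pairs of a step and a shorter efficient chain,
  -- and the factor lost depends on that chain only through its end `ρ`.
  efficientSum-step : (π σ : NC n) → π ≢ σ → efficientSum π σ ≈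
    ∑ (allNC n) (λ ρ → when (isStep? π ρ σ) (efficientSum π ρ * (sign ∣ σ ∖ π ∣ * M ρ σ)))
  efficientSum-step {n} π σ π≢σ = begin
    ∑ (EC π σ) term
      ≈⟨ ∑-unique (EC-unique π σ) (extensions-unique π σ) (∈-extensions⁺ π≢σ) (∈-extensions⁻ π σ) ⟩
    ∑ (extensions π σ) term
      ≈⟨ ∑-concatMap (λ ρ → map (extend σ) (EC π ρ)) ρs ⟩
    ∑ ρs (λ ρ → ∑ (map (extend σ) (EC π ρ)) term)
      ≈⟨ ∑-cong-∈ ρs (λ {ρ} ρ∈ → h ρ (proj₂ (∈-filter⁻ (λ ρ → isStep? π ρ σ) {xs = allNC n} ρ∈))) ⟩
    ∑ ρs (λ ρ → efficientSum π ρ * (sign ∣ σ ∖ π ∣ * M ρ σ))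
      ≈⟨ ∑-filter (λ ρ → isStep? π ρ σ) (allNC n) ⟩
    ∑ (allNC n) (λ ρ → when (isStep? π ρ σ) (efficientSum π ρ * (sign ∣ σ ∖ π ∣ * M ρ σ))) ∎
    where
    ρs = filter (λ ρ → isStep? π ρ σ) (allNC n)

    h : ∀ ρ → IsStep π ρ σ →
        ∑ (map (extend σ) (EC π ρ)) term ≈ efficientSum π ρ * (sign ∣ σ ∖ π ∣ * M ρ σ)
    h ρ st = begin
      ∑ (map (extend σ) (EC π ρ)) term
        ≈⟨ ∑-map (extend σ) (EC π ρ) ⟩
      ∑ (EC π ρ) (term ∘ extend σ)
        ≈⟨ ∑-cong-∈ (EC π ρ) (λ c∈ → term-extend st (Equivalence.to (∈-EC {π = π} {ρ}) c∈)) ⟩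
      ∑ (EC π ρ) (λ c → term c * (sign ∣ σ ∖ π ∣ * M ρ σ))
        ≈⟨ ∑-* (EC π ρ) (sign ∣ σ ∖ π ∣ * M ρ σ) ⟨
      efficientSum π ρ * (sign ∣ σ ∖ π ∣ * M ρ σ) ∎

  -- A partial merge chooses which of the `k` blocks of `σ` outside both `π` and `D` are merged, so
  -- this is the expansion of the `k`-th power of 1 - 1. One toggled block gives the vanishing
  -- without enumerating the choices.
  alternating-sum : (π σ : NC n) → π ≤ σ → {D : Subset n → Set} (D? : Decidable D) →
    (∀ {V} → D V → IsBlock σ V) → (all? : Dec (∀ V → IsBlock σ V → ¬ IsBlock π V → D V)) →
    ∑ (allNC n) (λ ρ → when (partialMerge? π σ D? ρ) (sign ∣ σ ∖ ρ ∣)) ≈ when all? 1#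
  alternating-sum {n} π σ π≤σ D? D⊆σ (yes all) = T.trans
    (∑-single (partialMerge? π σ D?) (allNC-unique n) (∈-allNC σ)
      (partialMerge π≤σ (≤-refl σ) (λ _ → D⊆σ) (λ _ V∈σ _ → V∈σ)) only-σ)
    (T.reflexive (≡.cong sign (∣σ∖σ∣≡0 σ)))
    where
    only-σ : ∀ {ρ} → PartialMerge π σ _ ρ → ρ ≡ σ
    only-σ {ρ} (partialMerge π≤ρ ρ≤σ D⊆ρ _) = blocks⊆⇒≡ ρ σ ρ≤σ λ V V∈σ → h V∈σ (isBlock? π V)
      where
      h : IsBlock σ V → Dec (IsBlock π V) → IsBlock ρ V
      h V∈σ (yes V∈π) = block-between π ρ σ π≤ρ ρ≤σ V∈π V∈σ
      h V∈σ (no V∉π)  = D⊆ρ _ (all _ V∈σ V∉π)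
  alternating-sum {n} π σ π≤σ {D} D? D⊆σ (no ¬all) =
    cancel (Any.any? (λ V → isBlock? σ V ×-dec ¬? (isBlock? π V) ×-dec ¬? (D? V)) (allSubsets n))
    where
    s : NC n → 𝒯
    s ρ = sign ∣ σ ∖ ρ ∣

    cancel-at : ∀ V → IsBlock σ V → ¬ IsBlock π V → ¬ D V →
                ∑ (allNC n) (λ ρ → when (partialMerge? π σ D? ρ) (s ρ)) ≈ 0#
    cancel-at V V∈σ V∉π V∉D = begin
      ∑ (allNC n) (λ ρ → when (partialMerge? π σ D? ρ) (s ρ))
        ≈⟨ ∑-cong (allNC n) (λ ρ → T.trans (when-split (isBlock? ρ V))
             (T.+-cong (when-× (isBlock? ρ V) (partialMerge? π σ D? ρ))
                       (when-× (¬? (isBlock? ρ V)) (partialMerge? π σ D? ρ)))) ⟩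
      ∑ (allNC n) (λ ρ → when (merged? ρ) (s ρ) + when (split? ρ) (s ρ))
        ≈⟨ ∑-∙ (allNC n) ⟩
      ∑ (allNC n) (λ ρ → when (merged? ρ) (s ρ)) + ∑ (allNC n) (λ ρ → when (split? ρ) (s ρ))
        ≈⟨ T.+-congʳ (∑-bijection {P = Tog.Split} {Tog.Merged} split? merged? (allNC-unique n) ∈-allNC
             (glue V σ) (glue V π) (λ {ρ} → Tog.split⇒merged {ρ}) (λ {ρ} → Tog.merged⇒split {ρ}) {s}) ⟩
      ∑ (allNC n) (λ ρ → when (split? ρ) (s (glue V σ ρ))) + ∑ (allNC n) (λ ρ → when (split? ρ) (s ρ))
        ≈⟨ ∑-∙ (allNC n) ⟨
      ∑ (allNC n) (λ ρ → when (split? ρ) (s (glue V σ ρ)) + when (split? ρ) (s ρ))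
        ≈⟨ ∑-cong (allNC n) (λ ρ → T.trans (T.sym (when-∙ (split? ρ)))
             (T.trans (when-cong (split? ρ) (opposite ρ)) (when-0 (split? ρ)))) ⟩
      ∑ (allNC n) (λ _ → 0#)
        ≈⟨ ∑-ε (allNC n) ⟩
      0# ∎
      where
      module Tog = Toggle π σ π≤σ D⊆σ V V∈σ V∉π V∉D

      merged? : Decidable Tog.Merged
      merged? ρ = isBlock? ρ V ×-dec partialMerge? π σ D? ρ

      split? : Decidable Tog.Split
      split? ρ = ¬? (isBlock? ρ V) ×-dec partialMerge? π σ D? ρ

      opposite : ∀ ρ → Tog.Split ρ → s (glue V σ ρ) + s ρ ≈ 0#
      opposite ρ ρ-split =
        sign-opposite ∣ σ ∖ ρ ∣ ∣ σ ∖ glue V σ ρ ∣ (Tog.split-count {ρ} ρ-split)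

      when-0 : ∀ {p} {P : Set p} (P? : Dec P) → when P? 0# ≈ 0#
      when-0 (yes _) = T.refl
      when-0 (no _)  = T.refl

    cancel : Dec (Any (λ V → IsBlock σ V × ¬ IsBlock π V × ¬ D V) (allSubsets n)) →
             ∑ (allNC n) (λ ρ → when (partialMerge? π σ D? ρ) (s ρ)) ≈ 0#
    cancel (no none) = contradiction (λ V V∈σ V∉π → decidable-stable (D? V) λ V∉D →
      none (Any.map (λ { refl → V∈σ , V∉π , V∉D }) (∈-allSubsets V))) ¬all
    cancel (yes some) = let V , V∈σ , V∉π , V∉D = Any.satisfied some in cancel-at V V∈σ V∉π V∉D

  -- One formula for both cases, so that it can be summed over all `τ`: for `τ ≡ σ` no step exists,
  -- as `ρ` would lie strictly below `σ` and above `τ`.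
  efficientSum-expand : (τ σ : NC n) → efficientSum τ σ ≈
    when (τ ≟ σ) 1#
      + ∑ (allNC n) (λ ρ → when (isStep? τ ρ σ) (efficientSum τ ρ * (sign ∣ σ ∖ τ ∣ * M ρ σ)))
  efficientSum-expand {n} τ σ = h (τ ≟ σ)
    where
    F : NC n → 𝒯
    F ρ = efficientSum τ ρ * (sign ∣ σ ∖ τ ∣ * M ρ σ)

    no-step : τ ≡ σ → ∀ ρ → ¬ IsStep τ ρ σ
    no-step refl ρ (step τ≤ρ (ρ≤τ , ρ≢τ) _) = ρ≢τ (≤-antisym ρ≤τ τ≤ρ)

    h : (τ≟σ : Dec (τ ≡ σ)) →
        efficientSum τ σ ≈ when τ≟σ 1# + ∑ (allNC n) (λ ρ → when (isStep? τ ρ σ) (F ρ))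
    h (yes τ≡σ) = begin
      efficientSum τ σ
        ≡⟨ ≡.cong (efficientSum τ) τ≡σ ⟨
      efficientSum τ τ
        ≈⟨ efficientSum-refl τ ⟩
      1#
        ≈⟨ T.+-identityʳ 1# ⟨
      1# + 0#
        ≈⟨ T.+-congˡ (T.trans
             (∑-cong (allNC n) (λ ρ → when-no (isStep? τ ρ σ) (no-step τ≡σ ρ))) (∑-ε (allNC n))) ⟨
      1# + ∑ (allNC n) (λ ρ → when (isStep? τ ρ σ) (F ρ)) ∎
    h (no τ≢σ) = T.trans (efficientSum-step τ σ τ≢σ) (T.sym (T.+-identityˡ _))

  -- The refined convolution identity

  module _ (π : NC n) where

    -- An empty `D` gives the whole interval from `π` to `σ`; for an interval ending at `ρ`, the
    -- choice `Common ρ σ` makes `contains` the separation required of a step.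
    record Between (σ : NC n) (D : Subset n → Set) (τ : NC n) : Set where
      constructor between
      field
        lower    : π ≤ τ
        upper    : τ ≤ σ
        contains : ∀ V → D V → IsBlock τ V

    between? : (σ : NC n) {D : Subset n → Set} → Decidable D → Decidable (Between σ D)
    between? σ D? τ = map′ (λ (l , u , c) → between l u c) (λ (between l u c) → l , u , c)
      ((π ≤? τ) ×-dec (τ ≤? σ) ×-dec ∀ₛ? λ V → D? V →-dec isBlock? τ V)

    Common : NC n → NC n → Subset n → Set
    Common ρ σ V = IsBlock ρ V × IsBlock σ V

    common? : (ρ σ : NC n) → Decidable (Common ρ σ)
    common? ρ σ V = isBlock? ρ V ×-dec isBlock? σ V

    All-new : (σ : NC n) → (Subset n → Set) → Set
    All-new σ D = ∀ V → IsBlock σ V → ¬ IsBlock π V → D V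

    all-new? : (σ : NC n) {D : Subset n → Set} → Decidable D → Dec (All-new σ D)
    all-new? σ D? = ∀ₛ? λ V → isBlock? σ V →-dec (¬? (isBlock? π V) →-dec D? V)

    convolution : (σ : NC n) {D : Subset n → Set} → Decidable D → 𝒯
    convolution σ D? = ∑ (allNC n) (λ τ → when (between? σ D? τ) (M π τ * efficientSum τ σ))

    -- Expanding efficientSum τ σ by the last but one term ρ of a chain makes the
    -- inner sum over τ a convolution ending at ρ with D = Common ρ σ.  By
    -- induction only the partial merges ρ survive; they all contribute
    -- ± M π σ, and the signs add up by alternating-sum.
    convolution-≈ : (σ : NC n) → Acc _<_ σ → π ≤ σ → {D : Subset n → Set} (D? : Decidable D) →
                    (∀ {V} → D V → IsBlock σ V) → convolution σ D? ≈ when (all-new? σ D?) (M π σ)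
    convolution-≈ σ (acc rs) π≤σ {D} D? D⊆σ = begin
      ∑ (allNC n) (λ τ → when (between? σ D? τ) (M π τ * efficientSum τ σ))
        ≈⟨ ∑-cong (allNC n) expand ⟩
      ∑ (allNC n) (λ τ → when (τ ≟ σ) (M π τ) + ∑ (allNC n) (B τ))
        ≈⟨ ∑-∙ (allNC n) ⟩
      ∑ (allNC n) (λ τ → when (τ ≟ σ) (M π τ)) + ∑ (allNC n) (λ τ → ∑ (allNC n) (B τ))
        ≈⟨ T.+-cong single (T.trans (∑-swap (allNC n) (allNC n)) (∑-cong (allNC n) inner)) ⟩
      M π σ + ∑ (allNC n) (λ ρ → when (proper? ρ) (U ρ))
        -- The one-term chain at `τ ≡ σ` supplies exactly the summand `ρ ≡ σ` that completes the sum
        -- over partial merges.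
        ≈⟨ T.+-congʳ top ⟨
      ∑ (allNC n) (λ ρ → when (top? ρ) (U ρ)) + ∑ (allNC n) (λ ρ → when (proper? ρ) (U ρ))
        ≈⟨ ∑-∙ (allNC n) ⟨
      ∑ (allNC n) (λ ρ → when (top? ρ) (U ρ) + when (proper? ρ) (U ρ))
        ≈⟨ ∑-cong (allNC n) (λ ρ → T.trans
             (T.+-cong (T.sym (when-× (ρ ≟ σ) (partialMerge? π σ D? ρ)))
                       (T.sym (when-× (¬? (ρ ≟ σ)) (partialMerge? π σ D? ρ))))
             (T.trans (T.sym (when-split (ρ ≟ σ)))
               (T.sym (when-* (partialMerge? π σ D? ρ) (M π σ))))) ⟩
      ∑ (allNC n) (λ ρ → when (partialMerge? π σ D? ρ) (sign ∣ σ ∖ ρ ∣) * M π σ)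
        ≈⟨ ∑-* (allNC n) (M π σ) ⟨
      ∑ (allNC n) (λ ρ → when (partialMerge? π σ D? ρ) (sign ∣ σ ∖ ρ ∣)) * M π σ
        ≈⟨ T.*-congʳ (alternating-sum π σ π≤σ D? D⊆σ (all-new? σ D?)) ⟩
      when (all-new? σ D?) 1# * M π σ
        ≈⟨ when-* (all-new? σ D?) (M π σ) ⟩
      when (all-new? σ D?) (1# * M π σ)
        ≈⟨ when-cong (all-new? σ D?) (λ _ → T.*-identityˡ (M π σ)) ⟩
      when (all-new? σ D?) (M π σ) ∎
      where
      G : NC n → NC n → 𝒯
      G τ ρ = efficientSum τ ρ * (sign ∣ σ ∖ τ ∣ * M ρ σ)

      F : NC n → NC n → 𝒯
      F τ ρ = M π τ * G τ ρ

      B : NC n → NC n → 𝒯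
      B τ ρ = when (between? σ D? τ) (when (isStep? τ ρ σ) (F τ ρ))

      steps : NC n → 𝒯
      steps τ = ∑ (allNC n) (λ ρ → when (isStep? τ ρ σ) (G τ ρ))

      U : NC n → 𝒯
      U ρ = sign ∣ σ ∖ ρ ∣ * M π σ

      top? : (ρ : NC n) → Dec (ρ ≡ σ × PartialMerge π σ D ρ)
      top? ρ = (ρ ≟ σ) ×-dec partialMerge? π σ D? ρ

      proper? : (ρ : NC n) → Dec (ρ ≢ σ × PartialMerge π σ D ρ)
      proper? ρ = ¬? (ρ ≟ σ) ×-dec partialMerge? π σ D? ρ

      expand : ∀ τ → when (between? σ D? τ) (M π τ * efficientSum τ σ) ≈
        when (τ ≟ σ) (M π τ) + ∑ (allNC n) (B τ)
      expand τ = begin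
        when (between? σ D? τ) (M π τ * efficientSum τ σ)
          ≈⟨ when-cong (between? σ D? τ) (λ _ →
               T.trans (T.*-congˡ (efficientSum-expand τ σ)) (T.distribˡ _ _ _)) ⟩
        when (between? σ D? τ) (M π τ * when (τ ≟ σ) 1# + M π τ * steps τ)
          ≈⟨ when-∙ (between? σ D? τ) ⟩
        when (between? σ D? τ) (M π τ * when (τ ≟ σ) 1#)
          + when (between? σ D? τ) (M π τ * steps τ)
          ≈⟨ T.+-cong first second ⟩
        when (τ ≟ σ) (M π τ) + ∑ (allNC n) (B τ) ∎
        where
        first : when (between? σ D? τ) (M π τ * when (τ ≟ σ) 1#) ≈ when (τ ≟ σ) (M π τ)
        first = T.trans
          (when-cong (between? σ D? τ) (λ _ → T.trans (*-when (τ ≟ σ) (M π τ))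
            (when-cong (τ ≟ σ) (λ _ → T.*-identityʳ (M π τ)))))
          (T.trans (when-× (between? σ D? τ) (τ ≟ σ))
            (when-⇔ (between? σ D? τ ×-dec (τ ≟ σ)) (τ ≟ σ) proj₂
              (λ { refl → between π≤σ (≤-refl σ) (λ _ → D⊆σ) , refl }) (λ _ → T.refl)))

        second : when (between? σ D? τ) (M π τ * steps τ) ≈
                 ∑ (allNC n) (B τ)
        second = T.trans
          (when-cong (between? σ D? τ) (λ _ → T.trans (*-∑ (M π τ) (allNC n))
            (∑-cong (allNC n) (λ ρ → *-when (isStep? τ ρ σ) (M π τ)))))
          (when-∑ (between? σ D? τ) (allNC n))

      single : ∑ (allNC n) (λ τ → when (τ ≟ σ) (M π τ)) ≈ M π σ
      single = ∑-single (_≟ σ) (allNC-unique n) (∈-allNC σ) refl id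

      top : ∑ (allNC n) (λ ρ → when (top? ρ) (U ρ)) ≈ M π σ
      top = T.trans
        (∑-single top? (allNC-unique n) (∈-allNC σ)
          (refl , partialMerge π≤σ (≤-refl σ) (λ _ → D⊆σ) (λ _ V∈σ _ → V∈σ)) proj₁)
        (T.trans (T.*-congʳ (T.reflexive (≡.cong sign (∣σ∖σ∣≡0 σ)))) (T.*-identityˡ (M π σ)))

      outer? : ∀ ρ → Dec (Between σ D ρ × ρ ≢ σ)
      outer? ρ = between? σ D? ρ ×-dec ¬? (ρ ≟ σ)

      inner? : ∀ ρ τ → Dec (Between ρ (Common ρ σ) τ)
      inner? ρ = between? ρ (common? ρ σ)

      -- The conditions are regrouped so that `outer?` is free of `τ`. The blocks in `D` pass from
      -- `τ` up to `ρ` by `block-between`, and back down because they are common to `ρ` and `σ`.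
      exchange : ∀ ρ τ → B τ ρ ≈
        when (outer? ρ) (when (inner? ρ τ) ((sign ∣ σ ∖ ρ ∣ * M ρ σ) * (M π τ * efficientSum τ ρ)))
      exchange ρ τ = T.trans (when-× (between? σ D? τ) (isStep? τ ρ σ)) (T.trans
        (when-⇔ (between? σ D? τ ×-dec isStep? τ ρ σ) (outer? ρ ×-dec inner? ρ τ) to from value)
        (T.sym (when-× (outer? ρ) (inner? ρ τ))))
        where
        to : Between σ D τ × IsStep τ ρ σ → (Between σ D ρ × ρ ≢ σ) × Between ρ (Common ρ σ) τ
        to (between π≤τ τ≤σ D⊆τ , step τ≤ρ (ρ≤σ , ρ≢σ) sep) =
          ( between (≤-trans {π = π} {τ} {ρ} π≤τ τ≤ρ) ρ≤σ
              (λ V V∈D → block-between τ ρ σ τ≤ρ ρ≤σ (D⊆τ V V∈D) (D⊆σ V∈D))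
          , ρ≢σ) ,
          between π≤τ τ≤ρ (λ V (V∈ρ , V∈σ) → sep V V∈ρ V∈σ)

        from : (Between σ D ρ × ρ ≢ σ) × Between ρ (Common ρ σ) τ → Between σ D τ × IsStep τ ρ σ
        from ((between π≤ρ ρ≤σ D⊆ρ , ρ≢σ) , between π≤τ τ≤ρ sep) =
          between π≤τ (≤-trans {π = τ} {ρ} {σ} τ≤ρ ρ≤σ) (λ V V∈D → sep V (D⊆ρ V V∈D , D⊆σ V∈D)) ,
          step τ≤ρ (ρ≤σ , ρ≢σ) (λ V V∈ρ V∈σ → sep V (V∈ρ , V∈σ))

        value : Between σ D τ × IsStep τ ρ σ →
                F τ ρ ≈ (sign ∣ σ ∖ ρ ∣ * M ρ σ) * (M π τ * efficientSum τ ρ)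
        value (_ , step τ≤ρ (ρ≤σ , _) sep) = begin
          M π τ * (efficientSum τ ρ * (sign ∣ σ ∖ τ ∣ * M ρ σ))
            ≈⟨ *-rearrange (M π τ) (efficientSum τ ρ) (sign ∣ σ ∖ τ ∣) (M ρ σ) ⟩
          (sign ∣ σ ∖ τ ∣ * M ρ σ) * (M π τ * efficientSum τ ρ)
            ≡⟨ ≡.cong (λ k → (sign k * M ρ σ) * (M π τ * efficientSum τ ρ))
                 (∣∖∣-cong σ τ ρ τ≤ρ ρ≤σ sep) ⟩
          (sign ∣ σ ∖ ρ ∣ * M ρ σ) * (M π τ * efficientSum τ ρ) ∎

      inner : ∀ ρ → ∑ (allNC n) (λ τ → B τ ρ) ≈
              when (proper? ρ) (U ρ)
      inner ρ = begin
        ∑ (allNC n) (λ τ → B τ ρ)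
          ≈⟨ ∑-cong (allNC n) (exchange ρ) ⟩
        ∑ (allNC n) (λ τ → when (outer? ρ) (when (inner? ρ τ) (C * (M π τ * efficientSum τ ρ))))
          ≈⟨ when-∑ (outer? ρ) (allNC n) ⟨
        when (outer? ρ) (∑ (allNC n) (λ τ → when (inner? ρ τ) (C * (M π τ * efficientSum τ ρ))))
          ≈⟨ when-cong (outer? ρ) induct ⟩
        when (outer? ρ) (when (all-new? ρ (common? ρ σ)) (C * M π ρ))
          ≈⟨ when-× (outer? ρ) (all-new? ρ (common? ρ σ)) ⟩
        when (outer? ρ ×-dec all-new? ρ (common? ρ σ)) (C * M π ρ)
          -- The condition left by the induction hypothesis says that every block of `ρ` outside `π`
          -- is a block of `σ`, which is the clause `merged`.
          ≈⟨ when-⇔ (outer? ρ ×-dec all-new? ρ (common? ρ σ)) (proper? ρ) to from value ⟩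
        when (proper? ρ) (U ρ) ∎
        where
        C : 𝒯
        C = sign ∣ σ ∖ ρ ∣ * M ρ σ

        induct : Between σ D ρ × ρ ≢ σ →
                 ∑ (allNC n) (λ τ → when (inner? ρ τ) (C * (M π τ * efficientSum τ ρ))) ≈
                 when (all-new? ρ (common? ρ σ)) (C * M π ρ)
        induct (between π≤ρ ρ≤σ _ , ρ≢σ) = begin
          ∑ (allNC n) (λ τ → when (inner? ρ τ) (C * (M π τ * efficientSum τ ρ)))
            ≈⟨ ∑-cong (allNC n) (λ τ → *-when (inner? ρ τ) C) ⟨
          ∑ (allNC n) (λ τ → C * when (inner? ρ τ) (M π τ * efficientSum τ ρ))
            ≈⟨ *-∑ C (allNC n) ⟨
          C * convolution ρ (common? ρ σ)
            ≈⟨ T.*-congˡ (convolution-≈ ρ (rs (ρ≤σ , ρ≢σ)) π≤ρ (common? ρ σ) proj₁) ⟩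
          C * when (all-new? ρ (common? ρ σ)) (M π ρ)
            ≈⟨ *-when (all-new? ρ (common? ρ σ)) C ⟩
          when (all-new? ρ (common? ρ σ)) (C * M π ρ) ∎

        to : (Between σ D ρ × ρ ≢ σ) × All-new ρ (Common ρ σ) → ρ ≢ σ × PartialMerge π σ D ρ
        to ((between π≤ρ ρ≤σ D⊆ρ , ρ≢σ) , new) =
          ρ≢σ , partialMerge π≤ρ ρ≤σ D⊆ρ (λ V V∈ρ V∉π → proj₂ (new V V∈ρ V∉π))

        from : ρ ≢ σ × PartialMerge π σ D ρ → (Between σ D ρ × ρ ≢ σ) × All-new ρ (Common ρ σ)
        from (ρ≢σ , partialMerge π≤ρ ρ≤σ D⊆ρ merged) =
          (between π≤ρ ρ≤σ D⊆ρ , ρ≢σ) , λ V V∈ρ V∉π → V∈ρ , merged V V∈ρ V∉π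

        value : (Between σ D ρ × ρ ≢ σ) × All-new ρ (Common ρ σ) → C * M π ρ ≈ U ρ
        value ((between π≤ρ ρ≤σ _ , _) , new) = begin
          (sign ∣ σ ∖ ρ ∣ * M ρ σ) * M π ρ  ≈⟨ T.*-assoc (sign ∣ σ ∖ ρ ∣) (M ρ σ) (M π ρ) ⟩
          sign ∣ σ ∖ ρ ∣ * (M ρ σ * M π ρ)  ≈⟨ T.*-congˡ (T.*-comm (M ρ σ) (M π ρ)) ⟩
          sign ∣ σ ∖ ρ ∣ * (M π ρ * M ρ σ)
            ≈⟨ T.*-congˡ (M-merge π ρ σ π≤ρ ρ≤σ (λ V V∈ρ V∉π → proj₂ (new V V∈ρ V∉π))) ⟩
          sign ∣ σ ∖ ρ ∣ * M π σ            ∎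

  -- The recursion and its uniqueness

  SatisfiesRecursion : (NC n → 𝒯) → Set _
  SatisfiesRecursion {n} f = ∀ π → π ≢ 𝟙 n → ∑ (allNC n) (λ σ → when (π ≤? σ) (M π σ * f σ)) ≈ 0#

  efficientSum-recursion : SatisfiesRecursion {n} (λ σ → efficientSum σ (𝟙 n))
  efficientSum-recursion {n} π π≢𝟙 = begin
    ∑ (allNC n) (λ τ → when (π ≤? τ) (M π τ * efficientSum τ (𝟙 n)))
      ≈⟨ ∑-cong (allNC n) (λ τ → when-⇔ (π ≤? τ) (between? π (𝟙 n) none? τ)
           (λ π≤τ → between π≤τ (≤𝟙 τ) (λ _ ())) Between.lower (λ _ → T.refl)) ⟩
    convolution π (𝟙 n) none?
      ≈⟨ convolution-≈ π (𝟙 n) (<-wellFounded n (𝟙 n)) (≤𝟙 π) none? (λ ()) ⟩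
    when (all-new? π (𝟙 n) none?) (M π (𝟙 n))
      -- With nothing prescribed, the surviving case would make every block of `𝟙 n` a block of `π`.
      ≈⟨ when-no (all-new? π (𝟙 n) none?) (λ all → π≢𝟙 (blocks⊆⇒≡ π (𝟙 n) (≤𝟙 π)
           λ V V∈𝟙 → decidable-stable (isBlock? π V) (all V V∈𝟙))) ⟩
    0# ∎
    where
    none? : Decidable {A = Subset n} (λ _ → ⊥)
    none? _ = no λ ()

  -- The linear system is unitriangular: the coefficient of `f π` is `M π π`, which is `1#`, and all
  -- other terms lie strictly above `π`.
  recursion-unique : {f g : NC n → 𝒯} → f (𝟙 n) ≈ g (𝟙 n) →
                     SatisfiesRecursion f → SatisfiesRecursion g →
                     ∀ π → Acc (flip _<_) π → f π ≈ g π
  recursion-unique {n} {f} {g} f𝟙≈g𝟙 f-rec g-rec π (acc rs) = h (π ≟ 𝟙 n)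
    where
    above : (NC n → 𝒯) → 𝒯
    above f = ∑ (allNC n) (λ σ → when (π <? σ) (M π σ * f σ))

    isolate : ∀ f → ∑ (allNC n) (λ σ → when (π ≤? σ) (M π σ * f σ)) ≈ f π + above f
    isolate f = begin
      ∑ (allNC n) (λ σ → when (π ≤? σ) (M π σ * f σ))
        ≈⟨ ∑-cong (allNC n) (λ σ → T.trans (when-split (π ≟ σ))
             (T.+-cong
               (T.trans (when-× (π ≟ σ) (π ≤? σ)) (when-⇔ ((π ≟ σ) ×-dec (π ≤? σ)) (σ ≟ π)
                 (≡.sym ∘ proj₁) (λ { refl → refl , ≤-refl π }) λ _ → T.refl))
               (T.trans (when-× (¬? (π ≟ σ)) (π ≤? σ)) (when-⇔ (¬? (π ≟ σ) ×-dec (π ≤? σ)) (π <? σ)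
                 (λ (π≢σ , π≤σ) → π≤σ , π≢σ) (λ (π≤σ , π≢σ) → π≢σ , π≤σ) λ _ → T.refl)))) ⟩
      ∑ (allNC n) (λ σ → when (σ ≟ π) (M π σ * f σ) + when (π <? σ) (M π σ * f σ))
        ≈⟨ ∑-∙ (allNC n) ⟩
      ∑ (allNC n) (λ σ → when (σ ≟ π) (M π σ * f σ)) + above f
        ≈⟨ T.+-congʳ (∑-single (_≟ π) (allNC-unique n) (∈-allNC π) refl id) ⟩
      M π π * f π + above f
        ≈⟨ T.+-congʳ (T.trans (T.*-congʳ (M-refl π)) (T.*-identityˡ (f π))) ⟩
      f π + above f ∎

    h : Dec (π ≡ 𝟙 n) → f π ≈ g π
    h (yes π≡𝟙) = ≡.subst (λ π → f π ≈ g π) (≡.sym π≡𝟙) f𝟙≈g𝟙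
    h (no π≢𝟙)  = TP.+-cancelʳ (above f) (f π) (g π) (begin
      f π + above f
        ≈⟨ isolate f ⟨
      ∑ (allNC n) (λ σ → when (π ≤? σ) (M π σ * f σ))
        ≈⟨ f-rec π π≢𝟙 ⟩
      0#
        ≈⟨ g-rec π π≢𝟙 ⟨
      ∑ (allNC n) (λ σ → when (π ≤? σ) (M π σ * g σ))
        ≈⟨ isolate g ⟩
      g π + above g
        ≈⟨ T.+-congˡ (∑-cong (allNC n) (λ σ → when-cong (π <? σ) (λ π<σ →
             T.*-congˡ (recursion-unique {f = f} {g} f𝟙≈g𝟙 f-rec g-rec σ (rs π<σ))))) ⟨
      g π + above f ∎)

  -- The antipode on generators

  module _ {S : 𝒯 → 𝒯} (isAntipode : IsAntipode S) where

    open IsAntipode isAntipode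
    antipode-1 : S 1# ≈ 1#
    -- `Δ 1#` is the pure tensor of `1#` with itself, so `(id ∗ S) 1#` computes to `1# * S 1#`.
    antipode-1 = T.trans (T.sym (T.*-identityˡ (S 1#))) (T.trans (inverseʳ 1#) (T.*-identityˡ 1#))

    antipode-recursion : SatisfiesRecursion {n} (S ∘ X)
    antipode-recursion {n} π π≢𝟙 = begin
      ∑ (allNC n) (λ σ → when (π ≤? σ) (M π σ * S (X σ)))
        ≈⟨ ∑-filter (π ≤?_) (allNC n) ⟨
      ∑ (filter (π ≤?_) (allNC n)) (λ σ → M π σ * S (X σ))
        ≡⟨ convolve (filter (π ≤?_) (allNC n)) ⟨
      (id ∗ S) (var (index n π π≢𝟙))
        -- The counit of a generator is zero by computation.
        ≈⟨ inverseʳ (var (index n π π≢𝟙)) ⟩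
      0# * 1#
        ≈⟨ T.zeroˡ 1# ⟩
      0# ∎
      where
      convolve : ∀ σs → multiply ((id ⊗₁ S) (foldr _+ₜ_ 0ₜ (map (λ σ → M π σ ⊗ X σ) σs)))
                 ≡ ∑ σs (λ σ → M π σ * S (X σ))
      convolve []       = refl
      convolve (σ ∷ σs) = ≡.cong (M π σ * S (X σ) +_) (convolve σs)

    antipode-X : (π : NC n) → S (X π) ≈ efficientSum π (𝟙 n)
    antipode-X {n} π = recursion-unique {f = S ∘ X} {λ σ → efficientSum σ (𝟙 n)}
      (begin
        S (X (𝟙 n))               ≡⟨ ≡.cong S (X-𝟙 n) ⟩
        S 1#                      ≈⟨ antipode-1 ⟩
        1#                        ≈⟨ efficientSum-refl (𝟙 n) ⟨
        efficientSum (𝟙 n) (𝟙 n)  ∎)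
      antipode-recursion efficientSum-recursion π (>-wellFounded n π)

theorem13p13 : ∀ {c ℓ} (K : CommutativeRing c ℓ) → let open HopfAlgebra K in
    (S : 𝒯 → 𝒯) → IsAntipode S →
    ∀ (n : ℕ) → n ≥ 1 → (π : NC n) → π ≢ 𝟙 n →
    S (X π) ≈ sum (map (λ ch → (- 1#) ^ length (Blocks⁺ ch) * Mᶜ ch) (EC π (𝟙 n)))
theorem13p13 K S isAntipode n _ π _ = Antipode.antipode-X K isAntipode π
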